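{- Let $f : 2^V \to \mathbb{Z}_{\ge 0}$ be a connectivity function and $(T,L)$ a branch decomposition of $f$ of width $k$ having $h \ge 1$ edges of width $k$. Let $uv$ be an edge of $T$ with $f(uv)=k$, inducing the bipartition $(W, V\setminus W)$ where $W$ is the set of elements of $V$ mapped to leaves on $u$'s side. If there exists a $W$-improvement, then there exists a $W$-improvement $(C_1,C_2,C_3)$ such that the refinement of $(T,L)$ with $(uv,C_1,C_2,C_3)$ has width at most $k$ and has fewer than $h$ edges of width $k$.
   Context: A connectivity function $f:2^V\to\mathbb{Z}_{\ge0}$ ($V$ finite) satisfies $f(\emptyset)=0$, $f(X)=f(V\setminus X)$, and $f(X\cup Y)+f(X\cap Y)\le f(X)+f(Y)$. A branch decomposition of $f$ is $(T,L)$ with $T$ a tree whose nodes have degree 1 or 3 and $L$ a bijection from $V$ to the leaves of $T$; an edge $e$ of $T$ induces via $T-e$ a bipartition $(X,V\setminus X)$ and has width $f(e)=f(X)$; the width of $(T,L)$ is the maximum edge width. For $W\subseteq V$, a $W$-improvement is a tripartition $(C_1,C_2,C_3)$ of $V$ (pairwise disjoint, possibly empty, union $V$) such that for each $i$: $f(C_i)<f(W)/2$, $f(C_i\cap W)<f(W)$ and $f(C_i\cap (V\setminus W))<f(W)$. A partial branch decomposition is a pair $(T,L)$ with $T$ as before and $L$ an injection from a subset of $V$ into the leaves. The refinement of $(T,L)$ with $(uv,C_1,C_2,C_3)$ is defined as follows: for each $i\in\{1,2,3\}$ take a copy $T_i$ of $T$ with labeling $L$ restricted to $C_i$, let $u_iv_i$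 be the copy of $uv$ in $T_i$, and subdivide $u_iv_i$ by a new node $w_i$; take the disjoint union of $T_1,T_2,T_3$ and add a new node $t$ adjacent to $w_1,w_2,w_3$; finally, repeatedly delete degree-1 nodes that are not labeled and suppress degree-2 nodes (a degree-2 node with neighbors $a,b$ is deleted and replaced by the edge $ab$). -}

module Defs where

open import Data.Bool using (false; if_then_else_)
open import Data.Fin using (Fin)
open import Data.Fin.Patterns using (0F; 1F; 2F)
import Data.Fin.Properties as Fin
open import Data.Fin.Subset using (Subset; ⊥; ⊤; ∁; _∩_; _∪_)
open import Data.List using (List; []; _∷_; _++_; length; map; mapMaybe; filter; concatMap; allFin; _∷ʳ_)
open import Data.List.Extrema.Nat using (max)
open import Data.List.Membership.Propositional using (_∈_; find; lose)
open import Data.List.Properties using (filter-notAll)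
open import Data.List.Relation.Unary.All using (All)
open import Data.List.Relation.Unary.AllPairs using (AllPairs)
open import Data.List.Relation.Unary.Any as Any using (Any; here; there)
open import Data.List.Relation.Unary.Linked using (Linked)
open import Data.List.Relation.Unary.Unique.Propositional using (Unique)
open import Data.Maybe as Maybe using (Maybe; just; nothing; maybe; _<∣>_)
import Data.Maybe.Properties as Maybe
open import Data.Nat using (ℕ; suc; _+_; _*_; _≤_; _<_; s≤s)
import Data.Nat.Properties as ℕ
open import Data.Product using (∃; _×_; _,_)
open import Data.Product.Properties using (≡-dec)
open import Data.Sum using (_⊎_; inj₁; inj₂; [_,_])
open import Data.Vec using (lookup; tabulate)
open import Function using (_∘_)
open import Relation.Binary.Construct.Closure.ReflexiveTransitive using (Star; ε; _◅_; _◅◅_; gmap)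
open import Relation.Binary.Definitions using (DecidableEquality)
open import Relation.Binary.PropositionalEquality using (_≡_; _≢_; refl; sym; trans; cong; subst)
open import Relation.Binary.PropositionalEquality.Properties using (isDecEquivalence)
open import Relation.Binary.Rewriting using (IsNormalForm; HasNormalForm)
open import Relation.Binary.TypeClasses using (IsDecEquivalence; _≟_)
open import Relation.Nullary using (¬_; Dec; yes; no; does; ¬?; contradiction)
open import Relation.Nullary.Decidable using (_×-dec_; _⊎-dec_; map′)

record IsConnectivityFunction {n} (f : Subset n → ℕ) : Set where
  field
    f-⊥         : f ⊥ ≡ 0
    symmetric   : ∀ X → f X ≡ f (∁ X)
    submodular  : ∀ X Y → f (X ∪ Y) + f (X ∩ Y) ≤ f X + f Y

record IsTripartition {n} (C : Fin 3 → Subset n) : Set where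
  field
    disjoint : ∀ {i j} → i ≢ j → C i ∩ C j ≡ ⊥
    covers   : C 0F ∪ C 1F ∪ C 2F ≡ ⊤

record IsImprovement {n} (f : Subset n → ℕ) (W : Subset n) (C : Fin 3 → Subset n) : Set where
  field
    isTripartition : IsTripartition C
    -- f (C i) < f W / 2 over the rationals
    half           : ∀ i → 2 * f (C i) < f W
    inside         : ∀ i → f (C i ∩ W) < f W
    outside        : ∀ i → f (C i ∩ ∁ W) < f W

-- An undirected edge is listed as a pair in one of its two orientations.
record Graph (N : Set) : Set where
  field
    nodes : List N
    edges : List (N × N)

Joins : {N : Set} → N × N → N → N → Set
Joins e x y = e ≡ (x , y) ⊎ e ≡ (y , x)

Adjacent : {N : Set} → List (N × N) → N → N → Set
Adjacent E x y = Any (λ e → Joins e x y) E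

Connected : {N : Set} → List (N × N) → N → N → Set
Connected E = Star (Adjacent E)

record IsSimple {N : Set} (G : Graph N) : Set where
  open Graph G
  field
    uniqueNodes : Unique nodes
    endpoints   : All (λ (x , y) → x ∈ nodes × y ∈ nodes) edges
    noLoops     : All (λ (x , y) → x ≢ y) edges
    noParallels : AllPairs (λ e (x , y) → ¬ Joins e x y) edges

-- The cycle visits x, then xs, then returns to x.
IsCycle : {N : Set} → Graph N → N → List N → Set
IsCycle G x xs = 2 ≤ length xs × Unique (x ∷ xs) × Linked (Adjacent (Graph.edges G)) (x ∷ xs ∷ʳ x)

record IsTree {N : Set} (G : Graph N) : Set where
  open Graph G
  field
    isSimple  : IsSimple G
    nonempty  : ∃ λ x → x ∈ nodes
    connected : ∀ {x y} → x ∈ nodes → y ∈ nodes → Connected edges x y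
    acyclic   : ∀ x xs → ¬ IsCycle G x xs

-- The ground set is Fin n; elements outside the domain of the labelling get nothing.
record LabelledGraph (n : ℕ) (N : Set) : Set where
  field
    graph : Graph N
    label : Fin n → Maybe N
  open Graph graph public

private
  via : ∀ {N : Set} {e} {a b x y : N} {E} → Joins e a b → Connected E x a → Connected E b y → Connected (e ∷ E) x y
  via j p q = gmap (λ z → z) there p ◅◅ here j ◅ gmap (λ z → z) there q

  -- A walk using e = (a , b) can be shortened to use it at most once.
  split : ∀ {N : Set} {a b x y : N} {E} → Connected ((a , b) ∷ E) x y →
          Connected E x y ⊎ (Connected E x a × Connected E b y) ⊎ (Connected E x b × Connected E a y)
  split ε = inj₁ ε
  split (here (inj₁ refl) ◅ p) with split p
  ... | inj₁ q              = inj₂ (inj₁ (ε , q))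
  ... | inj₂ (inj₁ (_ , q)) = inj₂ (inj₁ (ε , q))
  ... | inj₂ (inj₂ (_ , q)) = inj₁ q
  split (here (inj₂ refl) ◅ p) with split p
  ... | inj₁ q              = inj₂ (inj₂ (ε , q))
  ... | inj₂ (inj₁ (_ , q)) = inj₁ q
  ... | inj₂ (inj₂ (_ , q)) = inj₂ (inj₂ (ε , q))
  split (there s ◅ p) with split p
  ... | inj₁ q              = inj₁ (s ◅ q)
  ... | inj₂ (inj₁ (r , q)) = inj₂ (inj₁ (s ◅ r , q))
  ... | inj₂ (inj₂ (r , q)) = inj₂ (inj₂ (s ◅ r , q))

module _ {N : Set} ⦃ dec : IsDecEquivalence {A = N} _≡_ ⦄ where

  joins? : ∀ e (x y : N) → Dec (Joins e x y)
  joins? e x y = ≡-dec _≟_ _≟_ e (x , y) ⊎-dec ≡-dec _≟_ _≟_ e (y , x)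

  removeEdge : N → N → List (N × N) → List (N × N)
  removeEdge u v = filter (λ e → ¬? (joins? e u v))

  connected? : ∀ E (x y : N) → Dec (Connected E x y)
  connected? [] x y = map′ (λ { refl → ε }) (λ { ε → refl ; (() ◅ _) }) (x ≟ y)
  connected? ((a , b) ∷ E) x y = map′
    [ gmap (λ z → z) there , [ (λ (p , q) → via (inj₁ refl) p q) , (λ (p , q) → via (inj₂ refl) p q) ] ]
    split
    (connected? E x y ⊎-dec
      ((connected? E x a ×-dec connected? E b y) ⊎-dec (connected? E x b ×-dec connected? E a y)))

  opposite : N → N × N → Maybe N
  opposite x (a , b) =
    if does (x ≟ a) then just b else if does (x ≟ b) then just a else nothing

  neighbours : List (N × N) → N → List N
  neighbours E x = mapMaybe (opposite x) E

  degree : Graph N → N → ℕ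
  degree G x = length (neighbours (Graph.edges G) x)

  deleteNode : N → Graph N → Graph N
  deleteNode v G = record
    { nodes = filter (λ x → ¬? (x ≟ v)) nodes
    ; edges = filter (λ (x , y) → ¬? (x ≟ v) ×-dec ¬? (y ≟ v)) edges
    }
    where open Graph G

  addEdge : N → N → Graph N → Graph N
  addEdge a b G = record G { edges = (a , b) ∷ Graph.edges G }

  module _ {n : ℕ} where

    IsLeaf : LabelledGraph n N → N → Set
    IsLeaf D x = x ∈ nodes × degree graph x ≡ 1
      where open LabelledGraph D

    record IsBranchDecomposition (D : LabelledGraph n N) : Set where
      open LabelledGraph D
      field
        isTree          : IsTree graph
        degree-1-or-3   : ∀ {x} → x ∈ nodes → degree graph x ≡ 1 ⊎ degree graph x ≡ 3
        label-leaf      : ∀ x → ∃ λ l → label x ≡ just l × IsLeaf D l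
        label-injective : ∀ {x y} → label x ≡ label y → x ≡ y
        label-onto      : ∀ {l} → IsLeaf D l → ∃ λ x → label x ≡ just l

    -- The elements whose leaves lie in the component of u in T − uv.
    side : LabelledGraph n N → N → N → Subset n
    side D u v = tabulate (maybe (λ l → does (connected? (removeEdge u v edges) u l)) false ∘ label)
      where open LabelledGraph D

    -- In a tree the orientation of (u , v) is immaterial, by symmetry of f.
    edgeWidth : (Subset n → ℕ) → LabelledGraph n N → N × N → ℕ
    edgeWidth f D (u , v) = f (side D u v)

    width : (Subset n → ℕ) → LabelledGraph n N → ℕ
    width f D = max 0 (map (edgeWidth f D) (LabelledGraph.edges D))

    #edgesOfWidth : (Subset n → ℕ) → LabelledGraph n N → ℕ → ℕ
    #edgesOfWidth f D k = length (filter (λ e → edgeWidth f D e ℕ.≟ k) (LabelledGraph.edges D))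

    infix 4 _⟶_

    data _⟶_ (D : LabelledGraph n N) : LabelledGraph n N → Set where
      delete : ∀ {v a} → let open LabelledGraph D in
        v ∈ nodes → neighbours edges v ≡ a ∷ [] → (∀ x → label x ≢ just v) →
        D ⟶ record D { graph = deleteNode v graph }
      suppress : ∀ {v a b} → let open LabelledGraph D in
        v ∈ nodes → neighbours edges v ≡ a ∷ b ∷ [] →
        D ⟶ record D { graph = addEdge a b (deleteNode v graph) }

data RefinedNode (N : Set) : Set where
  copy   : Fin 3 → N → RefinedNode N
  subdiv : Fin 3 → RefinedNode N
  centre : RefinedNode N

private
  refinedNode-≟ : {N : Set} → DecidableEquality N → DecidableEquality (RefinedNode N)
  refinedNode-≟ _≟N_ (copy i x) (copy j y) =
    map′ (λ { (refl , refl) → refl }) (λ { refl → refl , refl }) ((i Fin.≟ j) ×-dec (x ≟N y))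
  refinedNode-≟ _≟N_ (copy i x) (subdiv j) = no λ ()
  refinedNode-≟ _≟N_ (copy i x) centre     = no λ ()
  refinedNode-≟ _≟N_ (subdiv i) (copy j y) = no λ ()
  refinedNode-≟ _≟N_ (subdiv i) (subdiv j) =
    map′ (λ { refl → refl }) (λ { refl → refl }) (i Fin.≟ j)
  refinedNode-≟ _≟N_ (subdiv i) centre     = no λ ()
  refinedNode-≟ _≟N_ centre     (copy j y) = no λ ()
  refinedNode-≟ _≟N_ centre     (subdiv j) = no λ ()
  refinedNode-≟ _≟N_ centre     centre     = yes refl

instance
  refinedNode-isDecEquivalence : {N : Set} ⦃ dec : IsDecEquivalence {A = N} _≡_ ⦄ →
                                 IsDecEquivalence {A = RefinedNode N} _≡_
  refinedNode-isDecEquivalence = isDecEquivalence (refinedNode-≟ _≟_)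

module _ {n : ℕ} {N : Set} ⦃ dec : IsDecEquivalence {A = N} _≡_ ⦄ where

  copyLabel : LabelledGraph n N → (Fin 3 → Subset n) → Fin 3 → Fin n → Maybe (RefinedNode N)
  copyLabel D C i x =
    if lookup (C i) x then Maybe.map (copy i) (LabelledGraph.label D x) else nothing

  -- The refinement before deletions and suppressions: the three copies of T
  -- with each copy of uv subdivided, joined at the centre.
  glued : LabelledGraph n N → N → N → (Fin 3 → Subset n) → LabelledGraph n (RefinedNode N)
  glued D u v C = record
    { graph = record
      { nodes = centre ∷ concatMap (λ i → subdiv i ∷ map (copy i) nodes) (allFin 3)
      ; edges = concatMap
          (λ i → (centre , subdiv i) ∷ (copy i u , subdiv i) ∷ (subdiv i , copy i v) ∷
                 map (λ (x , y) → copy i x , copy i y) (removeEdge u v edges))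
          (allFin 3)
      }
    ; label = λ x → copyLabel D C 0F x <∣> copyLabel D C 1F x <∣> copyLabel D C 2F x
    }
    where open LabelledGraph D

  IsRefinement : LabelledGraph n N → N → N → (Fin 3 → Subset n) → LabelledGraph n (RefinedNode N) → Set
  IsRefinement D u v C R = Star _⟶_ (glued D u v C) R × IsNormalForm _⟶_ R

-- The process of deleting and suppressing terminates, so a refinement always exists.

module _ {n : ℕ} {N : Set} ⦃ dec : IsDecEquivalence {A = N} _≡_ ⦄ where

  private
    size : LabelledGraph n N → ℕ
    size D = length (LabelledGraph.nodes D)

    shrinks : ∀ {D D′ : LabelledGraph n N} → D ⟶ D′ → size D′ < size D
    shrinks (delete v∈ _ _) = filter-notAll _ _ (Any.map (λ v≡ x≢ → x≢ (sym v≡)) v∈)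
    shrinks (suppress v∈ _) = filter-notAll _ _ (Any.map (λ v≡ x≢ → x≢ (sym v≡)) v∈)

    data ReducibleAt (D : LabelledGraph n N) (v : N) : Set where
      delete   : ∀ {a} → let open LabelledGraph D in
                 neighbours edges v ≡ a ∷ [] → (∀ x → label x ≢ just v) → ReducibleAt D v
      suppress : ∀ {a b} → let open LabelledGraph D in
                 neighbours edges v ≡ a ∷ b ∷ [] → ReducibleAt D v

    reducibleAt? : ∀ D v → Dec (ReducibleAt D v)
    reducibleAt? D v with neighbours (LabelledGraph.edges D) v in eq
    ... | []            = no λ { (delete p _) → contradiction (trans (sym eq) p) λ ()
                               ; (suppress p) → contradiction (trans (sym eq) p) λ () }
    ... | a ∷ []        = map′ (delete eq)
                               (λ { (delete _ q) → q
                                  ; (suppress p) → contradiction (trans (sym eq) p) λ () })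
                               (Fin.all? λ x → ¬? (Maybe.≡-dec _≟_ (LabelledGraph.label D x) (just v)))
    ... | a ∷ b ∷ []    = yes (suppress eq)
    ... | a ∷ b ∷ c ∷ _ = no λ { (delete p _) → contradiction (trans (sym eq) p) λ ()
                               ; (suppress p) → contradiction (trans (sym eq) p) λ () }

    step? : ∀ (D : LabelledGraph n N) → Dec (∃ (D ⟶_))
    step? D = map′ to from (Any.any? (reducibleAt? D) (LabelledGraph.nodes D))
      where
      to : Any (ReducibleAt D) (LabelledGraph.nodes D) → ∃ (D ⟶_)
      to r with find r
      ... | _ , v∈ , delete p q = _ , delete v∈ p q
      ... | _ , v∈ , suppress p = _ , suppress v∈ p
      from : ∃ (D ⟶_) → Any (ReducibleAt D) (LabelledGraph.nodes D)
      from (_ , delete v∈ p q) = lose v∈ (delete p q)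
      from (_ , suppress v∈ p) = lose v∈ (suppress p)

    normalise : ∀ m (D : LabelledGraph n N) → size D < m → HasNormalForm _⟶_ D
    normalise (suc m) D (s≤s D≤m) with step? D
    ... | no  stuck    = D , stuck , ε
    ... | yes (D′ , s) with normalise m D′ (ℕ.<-≤-trans (shrinks s) D≤m)
    ...   | R , nf , ss = R , nf , s ◅ ss

  hasNormalForm : ∀ (D : LabelledGraph n N) → HasNormalForm _⟶_ D
  hasNormalForm D = normalise _ D (ℕ.n<1+n _)

module _ {n : ℕ} {N : Set} ⦃ dec : IsDecEquivalence {A = N} _≡_ ⦄ where

  refinement-exists : ∀ (D : LabelledGraph n N) u v C → ∃ (IsRefinement D u v C)
  refinement-exists D u v C with hasNormalForm (glued D u v C)
  ... | R , nf , ss = R , ss , nf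

-- Among the W-improvements reachable by moving sets inside W or inside V ∖ W into one part, take
-- one that is locally minimal for f(C₁) + f(C₂) + f(C₃), ties being broken by |C₂| + 2 |C₃|.
-- Submodularity shows that then, for every X inside W or inside V ∖ W, f(X ∩ Cᵢ) ≤ f(X), with
-- equality for at most one i when f(X) ≥ 1. Every edge of T other than uv cuts off such a set X,
-- and its three copies in the refinement have widths f(X ∩ Cᵢ), while the new edges have widths
-- f(Cᵢ), f(Cᵢ ∩ W) and f(Cᵢ ∖ W), all below k. So already before deletions and suppressions no edge
-- is wider than k, and the edges of width k inject into those of T other than uv. Deleting an
-- unlabelled leaf or suppressing a node of degree 2 in a tree creates no new edge widths.

module Submission where

open import Defs
open import Data.Bool using (true; false; not; _∧_; _∨_; if_then_else_)
open import Data.Bool.Properties using (∨-identityʳ; ∨-zeroʳ; ∧-identityʳ; ∧-zeroʳ)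
import Data.Empty as Empty
open import Data.Fin as Fin using (Fin; toℕ)
open import Data.Fin.Patterns using (0F; 1F; 2F)
import Data.Fin.Properties as Fin
open import Data.Fin.Subset using (Subset; Nonempty; _⊆_; ⊤; ∁; _∩_; _∪_)
import Data.Fin.Subset as Subset
open import Data.Fin.Subset.Properties
  using ( anySubset?; _⊆?_; nonempty?; Empty-unique; ∉⊥; ∈⊤; ⊆⊤; ⊆-trans; ⊆-antisym
        ; x∈p∩q⁻; x∈p∩q⁺; x∈p∪q⁻; x∉p⇒x∈∁p; x∈∁p⇒x∉p; p∩q⊆p; p∩q⊆q; p⊆p∪q
        ; ∩-identityʳ; ∩-assoc; ∩-comm; ∩-distribʳ-∪)
open import Data.List using (List; []; _∷_; _++_; length; map; filter; allFin; _∷ʳ_)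
open import Data.List.Membership.Propositional using (_∈_; find; lose)
open import Data.List.Membership.Propositional.Properties
  using (∈-filter⁺; ∈-filter⁻; ∈-map⁺; ∈-map⁻; ∈-concatMap⁺; ∈-concatMap⁻; ∈-allFin)
open import Data.List.Properties using (filter-accept; filter-reject; filter-none; filter-++; length-++)
open import Data.List.Relation.Unary.All as All using (All; []; _∷_)
import Data.List.Relation.Unary.All.Properties as All
open import Data.List.Relation.Unary.AllPairs as AllPairs using (AllPairs; []; _∷_)
import Data.List.Relation.Unary.AllPairs.Properties as AllPairs
open import Data.List.Relation.Unary.Any as Any using (here; there)
open import Data.List.Relation.Unary.Linked using (Linked; [-]; _∷_)
open import Data.List.Relation.Unary.Unique.Propositional using (Unique)
open import Data.List.Relation.Unary.Unique.Propositional.Properties using (allFin⁺)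
open import Data.Maybe using (just; nothing; maybe)
open import Data.Maybe.Properties using (just-injective)
open import Data.Nat using (ℕ; suc; _+_; _*_; _≤_; _<_; _≥_; z≤n; s≤s)
open import Data.Nat.Induction using (<-wellFounded)
open import Data.Nat.ListAction using (sum)
import Data.Nat.Properties as ℕ
open import Data.List.Extrema ℕ.≤-totalOrder using (max≤v⁺; v≤max⁺)
open import Data.Product using (∃; _×_; _,_; proj₁; proj₂)
open import Data.Product.Relation.Binary.Lex.Strict using (×-Lex; ×-decidable; ×-wellFounded)
open import Data.Sum as Sum using (_⊎_; inj₁; inj₂)
open import Data.Vec using (lookup; tabulate)
open import Data.Vec.Properties
  using ( lookup-replicate; lookup-zipWith; lookup-map; lookup∘tabulate; tabulate∘lookup; tabulate-cong
        ; []=⇒lookup; lookup⇒[]=)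
open import Function using (_∘_; case_of_)
open import Induction.WellFounded using (Acc; acc)
open import Relation.Binary.Construct.Closure.ReflexiveTransitive
  using (Star; ε; _◅_; _◅◅_; gmap; reverse; kleisliStar)
open import Relation.Binary.Definitions using (tri<; tri≈; tri>)
open import Relation.Binary.PropositionalEquality
open import Relation.Binary.TypeClasses using (IsDecEquivalence; _≟_)
open import Relation.Nullary using (¬_; Dec; yes; no; does; ¬?; contradiction)
open import Relation.Nullary.Decidable
  using (_×-dec_; _⊎-dec_; _→-dec_; dec-true; dec-false; decidable-stable)
open import Relation.Unary using (Decidable)

-- The obstacle is that a move has to preserve nine bounds, three for each part, and not only the
-- sum of the widths. So a set P may join C i only if neither P ∩ C i nor any P ∖ C j with j ≠ i is
-- narrower than P. Then submodularity controls the part that grows and posimodularity the parts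
-- that shrink, while P, lying on one side of W, leaves every trace on the other side unchanged. The
-- weights 0, 1, 2 of the parts are pairwise distinct, so that of any two parts in which X keeps its
-- full width one is preferred. The rewriting leaves the class of branch decompositions, so the
-- graph half of the proof runs on a weaker invariant in which every edge is a bridge, a labelled
-- node has at most one neighbour, and every label is reachable from every edge. Edges are counted
-- by an arbitrary predicate on their width: one induction over the steps then serves both "wider
-- than k" and "equal to k".

-- Tripartitions as colourings, moves, and set identities

module _ {n : ℕ} where

  lookup-ext : {X Y : Subset n} → (∀ x → lookup X x ≡ lookup Y x) → X ≡ Y
  lookup-ext {X} {Y} eq = trans (sym (tabulate∘lookup X)) (trans (tabulate-cong eq) (tabulate∘lookup Y))

  lookup-∩ : ∀ X (Y : Subset n) x → lookup (X ∩ Y) x ≡ lookup X x ∧ lookup Y x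
  lookup-∩ X Y x = lookup-zipWith _∧_ x X Y

  lookup-∪ : ∀ X (Y : Subset n) x → lookup (X ∪ Y) x ≡ lookup X x ∨ lookup Y x
  lookup-∪ X Y x = lookup-zipWith _∨_ x X Y

  lookup-∁ : ∀ (X : Subset n) x → lookup (∁ X) x ≡ not (lookup X x)
  lookup-∁ X x = lookup-map x not X

  -- As a function to `Fin 3`, a tripartition needs no proof of disjointness or covering, and a
  -- moved set yields a tripartition again by construction.
  Colouring : Set
  Colouring = Fin n → Fin 3

  part : Colouring → Fin 3 → Subset n
  part c i = tabulate λ x → does (c x Fin.≟ i)

  move : Colouring → Fin 3 → Subset n → Colouring
  move c i P x = if lookup P x then i else c x

  part-lookup : ∀ c i x → lookup (part c i) x ≡ does (c x Fin.≟ i)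
  part-lookup c i x = lookup∘tabulate _ x

  x∈part⁺ : ∀ c {i x} → c x ≡ i → x Subset.∈ part c i
  x∈part⁺ c {i} {x} eq = lookup⇒[]= x _ (trans (part-lookup c i x) (dec-true (c x Fin.≟ i) eq))

  x∈part⁻ : ∀ c {i x} → x Subset.∈ part c i → c x ≡ i
  x∈part⁻ c {i} {x} x∈ with c x Fin.≟ i | trans (sym (part-lookup c i x)) ([]=⇒lookup x∈)
  ... | yes eq | _ = eq
  ... | no _ | ()

  part-isTripartition : ∀ c → IsTripartition (part c)
  part-isTripartition c = record
    { disjoint = λ {i} {j} i≢j → Empty-unique λ (x , x∈) →
        let x∈i , x∈j = x∈p∩q⁻ (part c i) (part c j) x∈ in
        i≢j (trans (sym (x∈part⁻ c x∈i)) (x∈part⁻ c x∈j))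
    ; covers = lookup-ext covers
    }
    where
    covers : ∀ x → lookup (part c 0F ∪ part c 1F ∪ part c 2F) x ≡ lookup ⊤ x
    covers x rewrite lookup-∪ (part c 0F) (part c 1F ∪ part c 2F) x
                   | lookup-∪ (part c 1F) (part c 2F) x
                   | part-lookup c 0F x | part-lookup c 1F x | part-lookup c 2F x
                   | lookup-replicate x true
      with c x
    ... | 0F = refl
    ... | 1F = refl
    ... | 2F = refl

  tripartition-colouring : ∀ {C} → IsTripartition C → ∃ λ c → ∀ i → C i ≡ part c i
  tripartition-colouring {C} tri = (λ x → proj₁ (colour x)) , λ i → ⊆-antisym
    (λ {x} x∈i → x∈part⁺ (proj₁ ∘ colour) (decidable-stable (_ Fin.≟ i) λ cx≢i →
      ∉⊥ (subst (x Subset.∈_) (disjoint cx≢i) (x∈p∩q⁺ (proj₂ (colour x) , x∈i)))))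
    (λ {x} x∈ → subst (λ j → x Subset.∈ C j) (x∈part⁻ (proj₁ ∘ colour) x∈) (proj₂ (colour x)))
    where
    open IsTripartition tri
    colour : ∀ x → ∃ λ i → x Subset.∈ C i
    colour x with x∈p∪q⁻ (C 0F) _ (subst (x Subset.∈_) (sym covers) ∈⊤)
    ... | inj₁ x∈ = 0F , x∈
    ... | inj₂ x∈ with x∈p∪q⁻ (C 1F) _ x∈
    ...   | inj₁ x∈ = 1F , x∈
    ...   | inj₂ x∈ = 2F , x∈

  part-move-same : ∀ c i P → part (move c i P) i ≡ part c i ∪ P
  part-move-same c i P = lookup-ext λ x →
    trans (part-lookup (move c i P) i x)
      (trans (bits (lookup P x) (c x))
        (sym (trans (lookup-∪ (part c i) P x) (cong (_∨ _) (part-lookup c i x)))))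
    where
    bits : ∀ p j → does ((if p then i else j) Fin.≟ i) ≡ does (j Fin.≟ i) ∨ p
    bits true  j = trans (dec-true (i Fin.≟ i) refl) (sym (∨-zeroʳ _))
    bits false j = sym (∨-identityʳ _)

  part-move-other : ∀ c {i j} P → j ≢ i → part (move c i P) j ≡ part c j ∩ ∁ P
  part-move-other c {i} {j} P j≢i = lookup-ext λ x →
    trans (part-lookup (move c i P) j x)
      (trans (bits (lookup P x) (c x))
        (sym (trans (lookup-∩ (part c j) (∁ P) x) (cong₂ _∧_ (part-lookup c j x) (lookup-∁ P x)))))
    where
    bits : ∀ p k → does ((if p then i else k) Fin.≟ j) ≡ does (k Fin.≟ j) ∧ not p
    bits true  k = trans (dec-false (i Fin.≟ j) (j≢i ∘ sym)) (sym (∧-zeroʳ _))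
    bits false k = sym (∧-identityʳ _)

  ⊆⇒∩≡ : {P S : Subset n} → P ⊆ S → P ∩ S ≡ P
  ⊆⇒∩≡ {P} {S} P⊆S = ⊆-antisym (p∩q⊆p P S) λ x∈P → x∈p∩q⁺ (x∈P , P⊆S x∈P)

  ∪-∩-⊆ : ∀ A {P S : Subset n} → P ⊆ S → (A ∪ P) ∩ S ≡ (A ∩ S) ∪ P
  ∪-∩-⊆ A {P} {S} P⊆S = trans (∩-distribʳ-∪ S A P) (cong ((A ∩ S) ∪_) (⊆⇒∩≡ P⊆S))

  ∩-absorb : ∀ A {P S : Subset n} → P ⊆ S → (A ∩ S) ∩ P ≡ P ∩ A
  ∩-absorb A {P} {S} P⊆S = begin
    (A ∩ S) ∩ P ≡⟨ ∩-assoc A S P ⟩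
    A ∩ (S ∩ P) ≡⟨ cong (A ∩_) (∩-comm S P) ⟩
    A ∩ (P ∩ S) ≡⟨ cong (A ∩_) (⊆⇒∩≡ P⊆S) ⟩
    A ∩ P       ≡⟨ ∩-comm A P ⟩
    P ∩ A       ∎
    where open ≡-Reasoning

  ∩-rotate : ∀ (A B S : Subset n) → (A ∩ B) ∩ S ≡ (A ∩ S) ∩ B
  ∩-rotate A B S = begin
    (A ∩ B) ∩ S ≡⟨ ∩-assoc A B S ⟩
    A ∩ (B ∩ S) ≡⟨ cong (A ∩_) (∩-comm B S) ⟩
    A ∩ (S ∩ B) ≡⟨ ∩-assoc A S B ⟨
    (A ∩ S) ∩ B ∎
    where open ≡-Reasoning

  ∩∁-relative : ∀ A {P S : Subset n} → P ⊆ S → P ∩ ∁ (A ∩ S) ≡ P ∩ ∁ A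
  ∩∁-relative A {P} {S} P⊆S = ⊆-antisym
    (λ x∈ → let x∈P , x∉ = x∈p∩q⁻ P _ x∈ in
      x∈p∩q⁺ (x∈P , x∉p⇒x∈∁p λ x∈A → x∈∁p⇒x∉p x∉ (x∈p∩q⁺ (x∈A , P⊆S x∈P))))
    (λ x∈ → let x∈P , x∉A = x∈p∩q⁻ P _ x∈ in
      x∈p∩q⁺ (x∈P , x∉p⇒x∈∁p λ x∈AS → x∈∁p⇒x∉p x∉A (proj₁ (x∈p∩q⁻ A S x∈AS))))

  ∪-∩-disjoint : ∀ A {P S : Subset n} → P ⊆ ∁ S → (A ∪ P) ∩ S ≡ A ∩ S
  ∪-∩-disjoint A {P} {S} P⊆∁S = ⊆-antisym
    (λ x∈ → let x∈A∪P , x∈S = x∈p∩q⁻ (A ∪ P) S x∈ in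
      case x∈p∪q⁻ A P x∈A∪P of λ
        { (inj₁ x∈A) → x∈p∩q⁺ (x∈A , x∈S)
        ; (inj₂ x∈P) → contradiction x∈S (x∈∁p⇒x∉p (P⊆∁S x∈P)) })
    (λ x∈ → let x∈A , x∈S = x∈p∩q⁻ A S x∈ in x∈p∩q⁺ (p⊆p∪q P x∈A , x∈S))

  ∩∁-∩-disjoint : ∀ A {P S : Subset n} → P ⊆ ∁ S → (A ∩ ∁ P) ∩ S ≡ A ∩ S
  ∩∁-∩-disjoint A {P} {S} P⊆∁S = ⊆-antisym
    (λ x∈ → let x∈A , x∈S = x∈p∩q⁻ _ S x∈ in x∈p∩q⁺ (proj₁ (x∈p∩q⁻ A _ x∈A) , x∈S))
    (λ x∈ → let x∈A , x∈S = x∈p∩q⁻ A S x∈ in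
      x∈p∩q⁺ (x∈p∩q⁺ (x∈A , x∉p⇒x∈∁p λ x∈P → x∈∁p⇒x∉p (P⊆∁S x∈P) x∈S) , x∈S))

  ∪∁≡∁∩∁ : ∀ (X Y : Subset n) → X ∪ ∁ Y ≡ ∁ (Y ∩ ∁ X)
  ∪∁≡∁∩∁ X Y = lookup-ext λ x →
    trans (trans (lookup-∪ X (∁ Y) x) (cong (_ ∨_) (lookup-∁ Y x)))
      (trans (bits (lookup X x) (lookup Y x))
        (sym (trans (lookup-∁ (Y ∩ ∁ X) x)
          (cong not (trans (lookup-∩ Y (∁ X) x) (cong (_ ∧_) (lookup-∁ X x)))))))
    where
    bits : ∀ a b → a ∨ not b ≡ not (b ∧ not a)
    bits true  true  = refl
    bits true  false = refl
    bits false true  = refl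
    bits false false = refl

  ⊆⊎⊆∁-flip : {P S : Subset n} → P ⊆ S ⊎ P ⊆ ∁ S → P ⊆ ∁ S ⊎ P ⊆ ∁ (∁ S)
  ⊆⊎⊆∁-flip (inj₁ P⊆S)  = inj₂ λ x∈P → x∉p⇒x∈∁p λ x∈∁S → x∈∁p⇒x∉p x∈∁S (P⊆S x∈P)
  ⊆⊎⊆∁-flip (inj₂ P⊆∁S) = inj₁ P⊆∁S

  -- Since distinct parts are disjoint, X can be shrunk by one part without touching its trace on
  -- another. Every argument that replaces X by X ∖ C j rests on this.
  ∩∁-part : ∀ c X {i j} → j ≢ i → (X ∩ ∁ (part c j)) ∩ part c i ≡ X ∩ part c i
  ∩∁-part c X {i} {j} j≢i = trans (∩-rotate X (∁ (part c j)) (part c i)) (⊆⇒∩≡ λ x∈ → x∉p⇒x∈∁p λ x∈j →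
    j≢i (trans (sym (x∈part⁻ c x∈j)) (x∈part⁻ c (proj₂ (x∈p∩q⁻ X (part c i) x∈)))))

  -- The colours count 0, 1 and 2, so this is the size of part `1F` plus twice the size of part
  -- `2F`; recolouring an element with a lower index decreases it.
  weight : Colouring → ℕ
  weight c = sum (map (toℕ ∘ c) (allFin n))

sum-map-mono-≤ : {A : Set} {g h : A → ℕ} → (∀ x → g x ≤ h x) → ∀ xs → sum (map g xs) ≤ sum (map h xs)
sum-map-mono-≤ g≤h []       = z≤n
sum-map-mono-≤ g≤h (x ∷ xs) = ℕ.+-mono-≤ (g≤h x) (sum-map-mono-≤ g≤h xs)

sum-map-mono-< : {A : Set} {g h : A → ℕ} → (∀ x → g x ≤ h x) → ∀ {x xs} → x ∈ xs → g x < h x →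
                 sum (map g xs) < sum (map h xs)
sum-map-mono-< g≤h {xs = _ ∷ xs} (here refl) g<h = ℕ.+-mono-<-≤ g<h (sum-map-mono-≤ g≤h xs)
sum-map-mono-< g≤h {xs = y ∷ _}  (there x∈)  g<h = ℕ.+-mono-≤-< (g≤h y) (sum-map-mono-< g≤h x∈ g<h)

-- Submodularity, admissible moves and stable improvements

module _ {n : ℕ} {f : Subset n → ℕ} (conn : IsConnectivityFunction f) where
  open IsConnectivityFunction conn

  -- Submodularity for X and ∁ Y: their union is the complement of Y ∖ X, and symmetry of f removes
  -- both complements.
  posimodular : ∀ X Y → f (X ∩ ∁ Y) + f (Y ∩ ∁ X) ≤ f X + f Y
  posimodular X Y = begin
    f (X ∩ ∁ Y) + f (Y ∩ ∁ X)     ≡⟨ ℕ.+-comm (f (X ∩ ∁ Y)) _ ⟩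
    f (Y ∩ ∁ X) + f (X ∩ ∁ Y)     ≡⟨ cong (_+ f (X ∩ ∁ Y)) (symmetric (Y ∩ ∁ X)) ⟩
    f (∁ (Y ∩ ∁ X)) + f (X ∩ ∁ Y) ≡⟨ cong (λ Z → f Z + f (X ∩ ∁ Y)) (∪∁≡∁∩∁ X Y) ⟨
    f (X ∪ ∁ Y) + f (X ∩ ∁ Y)     ≤⟨ submodular X (∁ Y) ⟩
    f X + f (∁ Y)                 ≡⟨ cong (f X +_) (symmetric Y) ⟨
    f X + f Y                     ∎
    where open ℕ.≤-Reasoning

  -- Supplies the element whose recolouring makes a drop in weight strict. This is where positivity
  -- of the width enters the tie-breaking.
  nonempty-of-positive : ∀ {X} → 1 ≤ f X → Nonempty X
  nonempty-of-positive {X} 1≤fX with nonempty? X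
  ... | yes ne = ne
  ... | no  ¬ne = contradiction (subst (1 ≤_) (trans (cong f (Empty-unique ¬ne)) f-⊥) 1≤fX) λ ()

  -- The two conditions are what `absorb` and `expel` need in order to conclude that neither the
  -- receiving part nor the losing parts become wider.
  Movable : Colouring {n} → Fin 3 → Subset n → Set
  Movable c i P = f P ≤ f (P ∩ part c i) × (∀ j → j ≢ i → f P ≤ f (P ∩ ∁ (part c j)))

  -- Submodularity for C i ∩ S and P. Keeping S general lets one inequality serve whole parts, with
  -- S = ⊤, as well as their traces on W and ∁ W.
  absorb : ∀ c i {P S} → P ⊆ S →
           f (part (move c i P) i ∩ S) + f (P ∩ part c i) ≤ f (part c i ∩ S) + f P
  absorb c i {P} {S} P⊆S = subst₂ (λ X Y → f X + f Y ≤ f (part c i ∩ S) + f P)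
    (sym (trans (cong (_∩ S) (part-move-same c i P)) (∪-∩-⊆ (part c i) P⊆S)))
    (∩-absorb (part c i) P⊆S)
    (submodular (part c i ∩ S) P)

  -- The counterpart of `absorb` for a part that loses P: posimodularity for C j ∩ S and P, where
  -- removing C j ∩ S from P is the same as removing C j because P ⊆ S.
  expel : ∀ c {i j} {P S} → j ≢ i → P ⊆ S →
          f (part (move c i P) j ∩ S) + f (P ∩ ∁ (part c j)) ≤ f (part c j ∩ S) + f P
  expel c {i} {j} {P} {S} j≢i P⊆S = subst₂ (λ X Y → f X + f Y ≤ f (part c j ∩ S) + f P)
    (sym (trans (cong (_∩ S) (part-move-other c P j≢i)) (∩-rotate (part c j) (∁ P) S)))
    (∩∁-relative (part c j) P⊆S)
    (posimodular (part c j ∩ S) P)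

  cancel : ∀ {a b x y} → a + b ≤ x + y → y ≤ b → a ≤ x
  cancel {a} {b} {x} {y} le y≤b = ℕ.+-cancelʳ-≤ b a x (ℕ.≤-trans le (ℕ.+-monoʳ-≤ x y≤b))

  move-≤ : ∀ c i {P S} → Movable c i P → P ⊆ S ⊎ P ⊆ ∁ S → ∀ j →
           f (part (move c i P) j ∩ S) ≤ f (part c j ∩ S)
  move-≤ c i {P} {S} (same , other) hom j with j Fin.≟ i
  move-≤ c i {P} {S} (same , other) (inj₁ P⊆S) j | yes refl = cancel (absorb c j P⊆S) same
  move-≤ c i {P} {S} (same , other) (inj₁ P⊆S) j | no j≢i = cancel (expel c j≢i P⊆S) (other j j≢i)
  move-≤ c i {P} {S} (same , other) (inj₂ P⊆∁S) j | yes refl = ℕ.≤-reflexive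
    (cong f (trans (cong (_∩ S) (part-move-same c j P)) (∪-∩-disjoint (part c j) P⊆∁S)))
  move-≤ c i {P} {S} (same , other) (inj₂ P⊆∁S) j | no j≢i = ℕ.≤-reflexive
    (cong f (trans (cong (_∩ S) (part-move-other c P j≢i)) (∩∁-∩-disjoint (part c j) P⊆∁S)))

  absorb⊤ : ∀ c i P → f (part (move c i P) i) + f (P ∩ part c i) ≤ f (part c i) + f P
  absorb⊤ c i P = subst₂ (λ X Y → f X + f (P ∩ part c i) ≤ f Y + f P) (∩-identityʳ _) (∩-identityʳ _)
    (absorb c i {P} {⊤} ⊆⊤)

  move-≤⊤ : ∀ c i {P} → Movable c i P → ∀ j → f (part (move c i P) j) ≤ f (part c j)
  move-≤⊤ c i {P} mv j = subst₂ (λ X Y → f X ≤ f Y) (∩-identityʳ _) (∩-identityʳ _)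
    (move-≤ c i {P} {⊤} mv (inj₁ ⊆⊤) j)

  totalWidth : Colouring {n} → ℕ
  totalWidth c = f (part c 0F) + (f (part c 1F) + f (part c 2F))

  totalWidth-mono-≤ : ∀ {c d} → (∀ j → f (part c j) ≤ f (part d j)) → totalWidth c ≤ totalWidth d
  totalWidth-mono-≤ le = ℕ.+-mono-≤ (le 0F) (ℕ.+-mono-≤ (le 1F) (le 2F))

  totalWidth-mono-< : ∀ {c d} → (∀ j → f (part c j) ≤ f (part d j)) →
                      ∀ i → f (part c i) < f (part d i) → totalWidth c < totalWidth d
  totalWidth-mono-< le 0F lt = ℕ.+-mono-<-≤ lt (ℕ.+-mono-≤ (le 1F) (le 2F))
  totalWidth-mono-< le 1F lt = ℕ.+-mono-≤-< (le 0F) (ℕ.+-mono-<-≤ lt (le 2F))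
  totalWidth-mono-< le 2F lt = ℕ.+-mono-≤-< (le 0F) (ℕ.+-mono-≤-< (le 1F) lt)

  measure : Colouring {n} → ℕ × ℕ
  measure c = totalWidth c , weight c

  infix 4 _≺_

  _≺_ : ℕ × ℕ → ℕ × ℕ → Set
  _≺_ = ×-Lex _≡_ _<_ _<_

  module _ (W : Subset n) where

    Homogeneous : Subset n → Set
    Homogeneous P = P ⊆ W ⊎ P ⊆ ∁ W

    homogeneous-⊆ : ∀ {P Q} → P ⊆ Q → Homogeneous Q → Homogeneous P
    homogeneous-⊆ {P} P⊆Q (inj₁ Q⊆W)  = inj₁ (⊆-trans {i = P} P⊆Q Q⊆W)
    homogeneous-⊆ {P} P⊆Q (inj₂ Q⊆∁W) = inj₂ (⊆-trans {i = P} P⊆Q Q⊆∁W)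

    -- The three families of bounds are the monotonicity of moves for S = ⊤, W and ∁ W; homogeneity
    -- puts P inside or outside each of these S.
    move-improvement : ∀ c i {P} → Homogeneous P → Movable c i P →
                       IsImprovement f W (part c) → IsImprovement f W (part (move c i P))
    move-improvement c i {P} hom mv imp = record
      { isTripartition = part-isTripartition (move c i P)
      ; half    = λ j → ℕ.≤-<-trans (ℕ.*-monoʳ-≤ 2 (move-≤⊤ c i mv j)) (half j)
      ; inside  = λ j → ℕ.≤-<-trans (move-≤ c i mv hom j) (inside j)
      ; outside = λ j → ℕ.≤-<-trans (move-≤ c i mv (⊆⊎⊆∁-flip hom) j) (outside j)
      }
      where
      open IsImprovement imp

    improvement-colouring : ∃ (IsImprovement f W) → ∃ λ c → IsImprovement f W (part c)
    improvement-colouring (C , imp) with tripartition-colouring (IsImprovement.isTripartition imp)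
    ... | c , C≡ = c , record
      { isTripartition = part-isTripartition c
      ; half    = λ i → subst (λ X → 2 * f X < f W) (C≡ i) (half i)
      ; inside  = λ i → subst (λ X → f (X ∩ W) < f W) (C≡ i) (inside i)
      ; outside = λ i → subst (λ X → f (X ∩ ∁ W) < f W) (C≡ i) (outside i)
      }
      where open IsImprovement imp

    Stable : Colouring {n} → Set
    Stable c = ∀ P i → Homogeneous P → Movable c i P → ¬ (measure (move c i P) ≺ measure c)

    -- There are finitely many P and i, so an admissible move that lowers the measure can be
    -- searched for. The failure of the search is stability, and its success feeds a well-founded
    -- recursion.
    stable-improvement : ∀ c → IsImprovement f W (part c) → Acc _≺_ (measure c) →
                         ∃ λ d → IsImprovement f W (part d) × Stable d
    stable-improvement c imp (acc rs) with improvable?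
      where
      improvable? : Dec (∃ λ P → ∃ λ i → (Homogeneous P × Movable c i P) × measure (move c i P) ≺ measure c)
      improvable? = anySubset? λ P → Fin.any? λ i →
        (((P ⊆? W) ⊎-dec (P ⊆? ∁ W)) ×-dec
         ((f P ℕ.≤? f (P ∩ part c i)) ×-dec
          Fin.all? λ j → ¬? (j Fin.≟ i) →-dec (f P ℕ.≤? f (P ∩ ∁ (part c j))))) ×-dec
        ×-decidable ℕ._≟_ ℕ._<?_ ℕ._<?_ (measure (move c i P)) (measure c)
    ... | yes (P , i , (hom , mv) , lt) =
          stable-improvement (move c i P) (move-improvement c i hom mv imp) (rs lt)
    ... | no ¬imp = c , imp , λ P i hom mv lt → ¬imp (P , i , (hom , mv) , lt)

    module _ {c : Colouring {n}} (stable : Stable c) where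

      -- If X ∩ C i were wider than X, then shrinking X towards X ∩ C i as long as the width drops
      -- would lead to a set whose absorption by C i narrows the tripartition.
      part-≤ : ∀ X i → Homogeneous X → f (X ∩ part c i) ≤ f X
      part-≤ X = go X (<-wellFounded (f X))
        where
        go : ∀ X → Acc _<_ (f X) → ∀ i → Homogeneous X → f (X ∩ part c i) ≤ f X
        go X (acc rs) i hom = ℕ.≮⇒≥ λ fX<fXi →
          case Fin.any? (λ j → ¬? (j Fin.≟ i) ×-dec (f (X ∩ ∁ (part c j)) ℕ.<? f X)) of λ
          { (yes (j , j≢i , lt)) →
              let X′   = X ∩ ∁ (part c j)
                  X′∩i : X′ ∩ part c i ≡ X ∩ part c i
                  X′∩i = ∩∁-part c X j≢i
              in ℕ.<-irrefl refl (ℕ.<-trans fX<fXi (ℕ.≤-<-trans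
                   (subst (λ Y → f Y ≤ f X′) X′∩i (go X′ (rs lt) i (homogeneous-⊆ (p∩q⊆p X _) hom))) lt))
          ; (no ¬any) →
              let mv = ℕ.<⇒≤ fX<fXi , λ j j≢i → ℕ.≮⇒≥ λ lt → ¬any (j , j≢i , lt)
              in stable X i hom mv (inj₁ (totalWidth-mono-< {move c i X} {c} (move-≤⊤ c i mv) i
                   (ℕ.+-cancelʳ-< (f (X ∩ part c i)) _ _
                     (ℕ.≤-<-trans (absorb⊤ c i X) (ℕ.+-monoʳ-< (f (part c i)) fX<fXi))))) }

      -- Once `part-≤` is known, the condition on the losing parts is automatic: X ∖ C j has the
      -- same trace on C i as X, so it is at least as wide as X ∩ C i, hence as X.
      movable : ∀ {X i} → Homogeneous X → f X ≤ f (X ∩ part c i) → Movable c i X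
      movable {X} {i} hom fX≤fXi = fX≤fXi , λ j j≢i → ℕ.≤-trans fX≤fXi
        (subst (λ Y → f Y ≤ f (X ∩ ∁ (part c j))) (∩∁-part c X j≢i)
          (part-≤ (X ∩ ∁ (part c j)) i (homogeneous-⊆ (p∩q⊆p X _) hom)))

      -- The move is admissible, so it does not raise the total width; a lower weight would then
      -- lower the lexicographic measure.
      no-lower-weight : ∀ {X i} → Homogeneous X → f X ≤ f (X ∩ part c i) →
                        ¬ (weight (move c i X) < weight c)
      no-lower-weight {X} {i} hom fX≤fXi lt = stable X i hom mv
        (case ℕ.m≤n⇒m<n∨m≡n (totalWidth-mono-≤ {move c i X} {c} (move-≤⊤ c i mv)) of λ
          { (inj₁ <) → inj₁ < ; (inj₂ ≡) → inj₂ (≡ , lt) })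
        where mv = movable hom fX≤fXi

      -- No part becomes wider in an admissible move, so a single narrower part would already lower
      -- the total width.
      move-preserves-width : ∀ {X i} → Homogeneous X → f X ≤ f (X ∩ part c i) →
                             ∀ j → f (part c j) ≤ f (part (move c i X) j)
      move-preserves-width {X} {i} hom fX≤fXi j = ℕ.≮⇒≥ λ lt →
        stable X i hom mv (inj₁ (totalWidth-mono-< {move c i X} {c} (move-≤⊤ c i mv) j lt))
        where mv = movable hom fX≤fXi

      lower-weight : ∀ {X i} → (∀ {x} → x Subset.∈ X → toℕ i ≤ toℕ (c x)) →
                     ∀ {x} → x Subset.∈ X → toℕ i < toℕ (c x) → weight (move c i X) < weight c
      lower-weight {X} {i} i≤ {x} x∈X i<cx = sum-map-mono-< le (∈-allFin x) lt
        where
        le : ∀ y → toℕ (move c i X y) ≤ toℕ (c y)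
        le y with lookup X y in eq
        ... | true  = i≤ (lookup⇒[]= y X eq)
        ... | false = ℕ.≤-refl
        lt : toℕ (move c i X x) < toℕ (c x)
        lt rewrite []=⇒lookup x∈X = i<cx

      -- If X ∩ C 0 is as wide as X, then C 0 absorbs X. If both X ∩ C 1 and X ∩ C 2 are, then
      -- removing X from C 0 does not narrow it, so X ∖ C 0 is no wider than X and C 1 absorbs it.
      part-<-increasing : ∀ {X} i j → toℕ i < toℕ j → Homogeneous X → 1 ≤ f X →
                          f X ≤ f (X ∩ part c i) → ¬ (f X ≤ f (X ∩ part c j))
      part-<-increasing {X} 0F j 0<j hom 1≤fX fX≤fXi fX≤fXj =
        no-lower-weight hom fX≤fXi (lower-weight (λ _ → z≤n) (p∩q⊆p X _ x∈)
          (subst (λ k → 0 < toℕ k) (sym (x∈part⁻ c (p∩q⊆q X _ x∈))) 0<j))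
        where
        x∈ = proj₂ (nonempty-of-positive (ℕ.≤-trans 1≤fX fX≤fXj))
      part-<-increasing 1F 1F (s≤s ()) _ _ _ _
      part-<-increasing 2F 2F (s≤s (s≤s ())) _ _ _ _
      part-<-increasing {X} 1F 2F _ hom 1≤fX fX≤fX₁ fX≤fX₂ =
        no-lower-weight (homogeneous-⊆ (p∩q⊆p X _) hom) fP≤fP₁
          (lower-weight 1≤c (x∈p∩q⁺ (p∩q⊆p X _ x∈ , x∉p⇒x∈∁p λ x∈C₀ →
              case trans (sym c≡2) (x∈part⁻ c x∈C₀) of λ ()))
            (subst (λ k → 1 < toℕ k) (sym c≡2) ℕ.≤-refl))
        where
        x∈ = proj₂ (nonempty-of-positive (ℕ.≤-trans 1≤fX fX≤fX₂))
        c≡2 = x∈part⁻ c (p∩q⊆q X _ x∈)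
        P = X ∩ ∁ (part c 0F)
        fP≤fX : f P ≤ f X
        fP≤fX = cancel (posimodular X (part c 0F))
          (subst (λ Y → f (part c 0F) ≤ f Y) (part-move-other c X λ ()) (move-preserves-width hom fX≤fX₁ 0F))
        fP≤fP₁ : f P ≤ f (P ∩ part c 1F)
        fP≤fP₁ = ℕ.≤-trans fP≤fX (ℕ.≤-trans fX≤fX₁ (ℕ.≤-reflexive (cong f (sym (∩∁-part c X λ ())))))
        1≤c : ∀ {y} → y Subset.∈ P → 1 ≤ toℕ (c y)
        1≤c {y} y∈ = ℕ.n≢0⇒n>0 λ eq → x∈∁p⇒x∉p (p∩q⊆q X _ y∈) (x∈part⁺ c (Fin.toℕ-injective eq))

      part-<-unique : ∀ {X i j} → Homogeneous X → 1 ≤ f X →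
                      f X ≤ f (X ∩ part c i) → f X ≤ f (X ∩ part c j) → i ≡ j
      part-<-unique {X} {i} {j} hom 1≤ fi fj with Fin.<-cmp i j
      ... | tri< i<j _ _ = contradiction fj (part-<-increasing i j i<j hom 1≤ fi)
      ... | tri≈ _ i≡j _ = i≡j
      ... | tri> _ _ j<i = contradiction fi (part-<-increasing j i j<i hom 1≤ fj)

-- Walks, bridges and bypassing a node

module _ {N : Set} where

  joins-comm : ∀ {e} {x y : N} → Joins e x y → Joins e y x
  joins-comm = Sum.swap

  joins-swap : ∀ {p q x y : N} → Joins (p , q) x y → Joins (q , p) x y
  joins-swap (inj₁ refl) = inj₂ refl
  joins-swap (inj₂ refl) = inj₁ refl

  joins-transfer : ∀ {e} {p q x y : N} → Joins e p q → Joins e x y → Joins (p , q) x y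
  joins-transfer (inj₁ refl) j = j
  joins-transfer (inj₂ refl) j = joins-swap j

  adjacent-sym : ∀ {E} {p q : N} → Adjacent E p q → Adjacent E q p
  adjacent-sym = Any.map joins-comm

  connected-sym : ∀ {E} {p q : N} → Connected E p q → Connected E q p
  connected-sym = reverse adjacent-sym

  connected-mono : ∀ {E F} → (∀ {p q : N} → Adjacent E p q → Adjacent F p q) →
                   ∀ {p q} → Connected E p q → Connected F p q
  connected-mono = gmap (λ z → z)

  ∈⇒adjacent : ∀ {E} {p q : N} → (p , q) ∈ E → Adjacent E p q
  ∈⇒adjacent = Any.map (inj₁ ∘ sym)

  connected-invariant : ∀ {E} (P : N → Set) → (∀ {p q} → Adjacent E p q → P p → P q) →
                        ∀ {p q} → Connected E p q → P p → P q
  connected-invariant P step ε        Pp = Pp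
  connected-invariant P step (s ◅ ss) Pp = connected-invariant P step ss (step s Pp)

  module _ {P : N × N → Set} (P? : Decidable P) where

    adjacent-filter⁺ : ∀ {E p q} → (∀ {e} → Joins e p q → P e) → Adjacent E p q → Adjacent (filter P? E) p q
    adjacent-filter⁺ Pe adj with find adj
    ... | _ , e∈ , j = lose (∈-filter⁺ P? e∈ (Pe j)) j

    adjacent-filter⁻ : ∀ {E p q} → Adjacent (filter P? E) p q → Adjacent E p q × ∃ λ e → Joins e p q × P e
    adjacent-filter⁻ {E} adj with find adj
    ... | e , e∈ , j = let e∈E , Pe = ∈-filter⁻ P? {xs = E} e∈ in lose e∈E j , e , j , Pe

  NotParallel : N × N → N × N → Set
  NotParallel e (x , y) = ¬ Joins e x y

module _ {N : Set} ⦃ dec : IsDecEquivalence {A = N} _≡_ ⦄ where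

  adjacent-removeEdge⁺ : ∀ {E} {x y p q : N} → ¬ Joins (p , q) x y → Adjacent E p q →
                         Adjacent (removeEdge x y E) p q
  adjacent-removeEdge⁺ {E} {x} {y} ¬j =
    adjacent-filter⁺ (λ e → ¬? (joins? e x y)) λ j j′ → ¬j (joins-transfer j j′)

  adjacent-removeEdge⁻ : ∀ {E} {x y p q : N} → Adjacent (removeEdge x y E) p q →
                         Adjacent E p q × ¬ Joins (p , q) x y
  adjacent-removeEdge⁻ {E} {x} {y} adj with adjacent-filter⁻ (λ e → ¬? (joins? e x y)) {E} adj
  ... | adjE , _ , inj₁ refl , ¬j = adjE , ¬j
  ... | adjE , _ , inj₂ refl , ¬j = adjE , ¬j ∘ joins-swap

  removeEdge-comm : ∀ {E} {x y p q : N} → Adjacent (removeEdge x y E) p q → Adjacent (removeEdge y x E) p q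
  removeEdge-comm {E} adj with adjacent-removeEdge⁻ {E} adj
  ... | adjE , ¬j = adjacent-removeEdge⁺ (¬j ∘ joins-comm) adjE

  connected-removeEdge : ∀ {E} {x y p q : N} → Connected (removeEdge x y E) p q → Connected E p q
  connected-removeEdge {E} = connected-mono (proj₁ ∘ adjacent-removeEdge⁻ {E})

  -- Cut the walk after its last use of the edge; what remains starts at an end of that edge.
  connected-via : ∀ {E} (x y : N) {p q} → Connected E p q →
                  let R = removeEdge x y E in Connected R p q ⊎ Connected R x q ⊎ Connected R y q
  connected-via x y ε = inj₁ ε
  connected-via x y (_◅_ {p} {p′} s ss) with joins? (p , p′) x y | connected-via x y ss
  ... | no ¬j          | inj₁ c = inj₁ (adjacent-removeEdge⁺ ¬j s ◅ c)
  ... | yes (inj₁ refl) | inj₁ c = inj₂ (inj₂ c)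
  ... | yes (inj₂ refl) | inj₁ c = inj₂ (inj₁ c)
  ... | _              | inj₂ c = inj₂ c

  connected-endpoint : ∀ {E} {x y q : N} → Connected E x q →
                       Connected (removeEdge x y E) x q ⊎ Connected (removeEdge x y E) y q
  connected-endpoint {x = x} {y} c with connected-via x y c
  ... | inj₁ c′ = inj₁ c′
  ... | inj₂ c′ = c′

  -- Acyclicity in the form that talks directly about sides. As `removeEdge` drops all parallel
  -- copies at once, this excludes loops and longer cycles but not parallel edges, which are tracked
  -- separately.
  Bridges : List (N × N) → Set
  Bridges E = ∀ {x y} → Adjacent E x y → ¬ Connected (removeEdge x y E) x y

  bridges⇒≢ : ∀ {E} → Bridges E → ∀ {x y} → Adjacent E x y → x ≢ y
  bridges⇒≢ br adj refl = br adj ε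

  -- The detour x, v, y survives the removal of xy.
  bridges⇒no-triangle : ∀ {E} → Bridges E → ∀ {x y v} → Adjacent E v x → Adjacent E v y → ¬ Adjacent E x y
  bridges⇒no-triangle br {x} {y} {v} vx vy xy = br xy
    (adjacent-removeEdge⁺ (λ { (inj₁ refl) → bridges⇒≢ br vy refl ; (inj₂ refl) → bridges⇒≢ br xy refl })
       (adjacent-sym vx) ◅
     adjacent-removeEdge⁺ (λ { (inj₁ refl) → bridges⇒≢ br vx refl ; (inj₂ refl) → bridges⇒≢ br xy refl })
       vy ◅ ε)

  opposite-joins⁺ : ∀ {e} {x y : N} → Joins e x y → opposite x e ≡ just y
  opposite-joins⁺ {x = x} {y} (inj₁ refl) rewrite dec-true (x ≟ x) refl = refl
  opposite-joins⁺ {x = x} {y} (inj₂ refl) with x ≟ y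
  ... | yes refl = refl
  ... | no _ rewrite dec-true (x ≟ x) refl = refl

  opposite-joins⁻ : ∀ {e} {x y : N} → opposite x e ≡ just y → Joins e x y
  opposite-joins⁻ {a , b} {x} eq with x ≟ a
  opposite-joins⁻ {a , b} {x} refl | yes refl = inj₁ refl
  ... | no _ with x ≟ b
  opposite-joins⁻ {a , b} {x} refl | no _ | yes refl = inj₂ refl

  ∈-neighbours⁺ : ∀ {E} {x y : N} → Adjacent E x y → y ∈ neighbours E x
  ∈-neighbours⁺ {e ∷ E} {x} (here j) rewrite opposite-joins⁺ j = here refl
  ∈-neighbours⁺ {e ∷ E} {x} (there adj) with opposite x e
  ... | just _  = there (∈-neighbours⁺ adj)
  ... | nothing = ∈-neighbours⁺ adj

  ∈-neighbours⁻ : ∀ {E} {x y : N} → y ∈ neighbours E x → Adjacent E x y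
  ∈-neighbours⁻ {e ∷ E} {x} y∈ with opposite x e in eq
  ... | nothing = there (∈-neighbours⁻ y∈)
  ∈-neighbours⁻ {e ∷ E} {x} (here refl) | just _ = here (opposite-joins⁻ eq)
  ∈-neighbours⁻ {e ∷ E} {x} (there y∈)  | just _ = there (∈-neighbours⁻ y∈)

  -- Used when a node of degree 2 is suppressed: its two listed neighbours are distinct, so the new
  -- edge is not a loop.
  neighbours-unique : ∀ {E} → AllPairs NotParallel E → ∀ (x : N) → Unique (neighbours E x)
  neighbours-unique {[]}    []         x = []
  neighbours-unique {e ∷ E} (np ∷ nps) x with opposite x e in eq
  ... | nothing = neighbours-unique nps x
  ... | just y  = All.tabulate (λ { y∈ refl → let e′ , e′∈ , j = find (∈-neighbours⁻ {E} y∈) in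
                    All.lookup np e′∈ (parallel (opposite-joins⁻ eq) j) })
                ∷ neighbours-unique nps x
    where
    parallel : ∀ {e a b p q} → Joins e p q → Joins (a , b) p q → Joins e a b
    parallel j (inj₁ refl) = j
    parallel j (inj₂ refl) = joins-comm j

  -- E′ is E with v deleted and its neighbours joined: both rewriting steps are of this form.
  record Bypass (E E′ : List (N × N)) (v : N) : Set where
    field
      irreflexive : ¬ Adjacent E v v
      old         : ∀ {p q} → Adjacent E p q → p ≢ v → q ≢ v → Adjacent E′ p q
      through     : ∀ {p q} → Adjacent E v p → Adjacent E v q → p ≡ q ⊎ Adjacent E′ p q
      adjacent⁻   : ∀ {p q} → Adjacent E′ p q →
                    (p ≢ v × q ≢ v) × (Adjacent E p q ⊎ (Adjacent E v p × Adjacent E v q))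

  module _ {E E′ : List (N × N)} {v : N} (bypass : Bypass E E′ v) where
    open Bypass bypass

    bypass-connected⁺ : ∀ {p l} → p ≢ v → l ≢ v → Connected E p l → Connected E′ p l
    bypass-connected⁺ p≢v l≢v c = proj₁ (go c l≢v) p≢v
      where
      -- The second component treats a walk that currently stands at v: it may be resumed at any
      -- neighbour a of v, in particular at the one from which v was entered.
      go : ∀ {p l} → Connected E p l → l ≢ v →
           (p ≢ v → Connected E′ p l) × (p ≡ v → ∀ {a} → Adjacent E v a → Connected E′ a l)
      go ε l≢v = (λ _ → ε) , λ l≡v → contradiction l≡v l≢v
      go (_◅_ {p} {q} s ss) l≢v with q ≟ v | go ss l≢v
      ... | yes refl | _ , via = (λ p≢v → via refl (adjacent-sym s)) , λ { refl → contradiction s irreflexive }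
      ... | no q≢v   | direct , _ = (λ p≢v → old s p≢v q≢v ◅ direct q≢v) ,
        λ { refl a~v → case through a~v s of λ
              { (inj₁ refl) → direct q≢v ; (inj₂ a~q) → a~q ◅ direct q≢v } }

    bypass-connected⁻ : ∀ {p l} → Connected E′ p l → Connected E p l
    bypass-connected⁻ = kleisliStar (λ z → z) λ s → case proj₂ (adjacent⁻ s) of λ
      { (inj₁ s′) → s′ ◅ ε ; (inj₂ (vp , vq)) → adjacent-sym vp ◅ vq ◅ ε }

    -- The only danger is that an edge added between two neighbours of v is parallel to xy and is
    -- removed with it; then x, y and v would form a triangle.
    bypass-removeEdge : Bridges E → ∀ {x y} → Adjacent E x y → x ≢ v → y ≢ v →
                        Bypass (removeEdge x y E) (removeEdge x y E′) v
    bypass-removeEdge br {x} {y} xy x≢v y≢v = record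
      { irreflexive = irreflexive ∘ proj₁ ∘ adjacent-removeEdge⁻ {E}
      ; old = λ s p≢v q≢v → let s′ , ¬j = adjacent-removeEdge⁻ {E} s in adjacent-removeEdge⁺ ¬j (old s′ p≢v q≢v)
      ; through = λ vp vq → let vp′ , _ = adjacent-removeEdge⁻ {E} vp
                                vq′ , _ = adjacent-removeEdge⁻ {E} vq in
          Sum.map₂ (adjacent-removeEdge⁺ λ { (inj₁ refl) → bridges⇒no-triangle br vp′ vq′ xy
                                           ; (inj₂ refl) → bridges⇒no-triangle br vq′ vp′ xy })
                   (through vp′ vq′)
      ; adjacent⁻ = λ s → let s′ , ¬j = adjacent-removeEdge⁻ {E′} s
                              ≢v , origin = adjacent⁻ s′ in
          ≢v , Sum.map (adjacent-removeEdge⁺ ¬j)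
                 (λ (vp , vq) → adjacent-removeEdge⁺ v-not-endpoint vp , adjacent-removeEdge⁺ v-not-endpoint vq)
                 origin
      }
      where
      v-not-endpoint : ∀ {p} → ¬ Joins (v , p) x y
      v-not-endpoint (inj₁ refl) = x≢v refl
      v-not-endpoint (inj₂ refl) = y≢v refl

-- The invariant and edge sides under a bypass

module _ {n : ℕ} {N : Set} ⦃ dec : IsDecEquivalence {A = N} _≡_ ⦄ where

  module _ (D : LabelledGraph n N) {u v : N} where
    open LabelledGraph D

    private
      lookup-side : ∀ {x l} → label x ≡ just l →
                    lookup (side D u v) x ≡ does (connected? (removeEdge u v edges) u l)
      lookup-side {x} eq = trans (lookup∘tabulate _ x)
        (cong (maybe (λ l → does (connected? (removeEdge u v edges) u l)) false) eq)

    ∈-side⁺ : ∀ {x l} → label x ≡ just l → Connected (removeEdge u v edges) u l → x Subset.∈ side D u v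
    ∈-side⁺ {x} {l} eq c = lookup⇒[]= x _ (trans (lookup-side eq) (dec-true (connected? _ u l) c))

    ∈-side⁻ : ∀ {x l} → label x ≡ just l → x Subset.∈ side D u v → Connected (removeEdge u v edges) u l
    ∈-side⁻ {x} {l} eq x∈
      with connected? (removeEdge u v edges) u l | trans (sym (lookup-side eq)) ([]=⇒lookup x∈)
    ... | yes c | _ = c
    ... | no _  | ()

  -- Unlabelled leaves and nodes of degree 2 are allowed, since the rewriting passes through them.
  -- `spans` is the form of connectedness that sides depend on: from either end of any edge, all
  -- labels can be reached.
  record Invariant (D : LabelledGraph n N) : Set where
    open LabelledGraph D
    field
      bridges     : Bridges edges
      noParallels : AllPairs NotParallel edges
      leaf        : ∀ {x l p q} → label x ≡ just l → Adjacent edges l p → Adjacent edges l q → p ≡ q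
      spans       : ∀ {p q} → Adjacent edges p q → ∀ x → ∃ λ l → label x ≡ just l × Connected edges p l

  module _ {D : LabelledGraph n N} (I : Invariant D) where
    open LabelledGraph D
    open Invariant I

    -- By `spans` each label is reachable from x, hence from x or from y without the edge; both at
    -- once would contradict that xy is a bridge.
    side-∁ : ∀ {x y} → Adjacent edges x y → side D y x ≡ ∁ (side D x y)
    side-∁ {x} {y} xy = ⊆-antisym
      (λ {z} z∈ → let l , eq , _ = spans xy z in x∉p⇒x∈∁p λ z∈′ →
        bridges xy (∈-side⁻ D eq z∈′ ◅◅
          connected-sym (connected-mono (removeEdge-comm {E = edges}) (∈-side⁻ D eq z∈))))
      (λ {z} z∉ → let l , eq , c = spans xy z in
        case connected-endpoint c of λ
          { (inj₁ c′) → contradiction (∈-side⁺ D eq c′) (x∈∁p⇒x∉p z∉)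
          ; (inj₂ c′) → ∈-side⁺ D eq (connected-mono (removeEdge-comm {E = edges}) c′) })

    edgeWidth-comm : ∀ {f : Subset n → ℕ} → IsConnectivityFunction f → ∀ {x y} → Adjacent edges x y →
                     edgeWidth f D (y , x) ≡ edgeWidth f D (x , y)
    edgeWidth-comm {f} conn xy = trans (cong f (side-∁ xy)) (sym (IsConnectivityFunction.symmetric conn _))

    edgeWidth-joins : ∀ {f : Subset n → ℕ} → IsConnectivityFunction f → ∀ {e x y} → Adjacent edges x y →
                      Joins e x y → edgeWidth f D e ≡ edgeWidth f D (x , y)
    edgeWidth-joins conn xy (inj₁ refl) = refl
    edgeWidth-joins conn xy (inj₂ refl) = edgeWidth-comm conn xy

  module _ {D D′ : LabelledGraph n N} (I : Invariant D) {v : N} where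
    open LabelledGraph D
    open Invariant I
    private module D′ = LabelledGraph D′

    module _ (bypass : Bypass edges D′.edges v) (label≡ : D′.label ≡ label)
             (unlabelled : ∀ x → label x ≢ just v)
             (degree-≤2 : ∀ {p q r} → Adjacent edges v p → Adjacent edges v q → p ≢ q →
                          Adjacent edges v r → r ≡ p ⊎ r ≡ q)
             (loopless : ∀ {p q} → Adjacent D′.edges p q → p ≢ q)
             where
      open Bypass bypass

      label≢v : ∀ {x l} → label x ≡ just l → l ≢ v
      label≢v eq refl = unlabelled _ eq

      -- An edge of `D′` is either old and avoids v, so that it differs from vx, or it joins
      -- neighbours of v. The only neighbours are x and y, and the edge xy itself has been removed.
      bypass-removeNew : ∀ {x y} → Adjacent edges v x → Adjacent edges v y → x ≢ y →
                         ∀ {p q} → Connected (removeEdge x y D′.edges) p q →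
                         Connected (removeEdge v x edges) p q
      bypass-removeNew {x} {y} vx vy x≢y = kleisliStar (λ z → z) step
        where
        step : ∀ {p q} → Adjacent (removeEdge x y D′.edges) p q → Connected (removeEdge v x edges) p q
        step {p} {q} s with adjacent-removeEdge⁻ {E = D′.edges} s
        ... | s′ , ¬j with adjacent⁻ s′
        ...   | (p≢v , q≢v) , inj₁ pq =
          adjacent-removeEdge⁺ (λ { (inj₁ refl) → p≢v refl ; (inj₂ refl) → q≢v refl }) pq ◅ ε
        ...   | _ , inj₂ (vp , vq) with degree-≤2 vx vy x≢y vp | degree-≤2 vx vy x≢y vq
        ...     | inj₁ refl | inj₁ refl = ε
        ...     | inj₁ refl | inj₂ refl = contradiction (inj₁ refl) ¬j
        ...     | inj₂ refl | inj₁ refl = contradiction (inj₂ refl) ¬j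
        ...     | inj₂ refl | inj₂ refl = ε

      -- For an old edge, a detour lifts back to `D`. For a new edge xy, a detour from x to y lifts
      -- to `D` without vx, and the edge yv extends it to a detour around the bridge vx.
      bypass-bridges : Bridges D′.edges
      bypass-bridges {x} {y} s c with adjacent⁻ s
      ... | (x≢v , y≢v) , inj₁ xy =
        bridges xy (bypass-connected⁻ (bypass-removeEdge bypass bridges xy x≢v y≢v) c)
      ... | (x≢v , y≢v) , inj₂ (vx , vy) = bridges vx
        (connected-sym (bypass-removeNew vx vy (loopless s) c ◅◅
          adjacent-removeEdge⁺ (λ { (inj₁ refl) → y≢v refl ; (inj₂ refl) → loopless s refl })
            (adjacent-sym vy) ◅ ε))

      -- A labelled l with a new edge is a neighbour of v, and by `leaf` that is its only old edge.
      -- Two new edges at l both lead to the one other neighbour of v.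
      bypass-leaf : ∀ {x l p q} → D′.label x ≡ just l → Adjacent D′.edges l p → Adjacent D′.edges l q → p ≡ q
      bypass-leaf {x} {l} eq lp lq with trans (cong (λ L → L x) (sym label≡)) eq | adjacent⁻ lp | adjacent⁻ lq
      ... | eq′ | _         , inj₁ lp′ | _         , inj₁ lq′ = leaf eq′ lp′ lq′
      ... | eq′ | (_ , p≢v) , inj₁ lp′ | _         , inj₂ (vl , _) =
        contradiction (leaf eq′ lp′ (adjacent-sym vl)) p≢v
      ... | eq′ | _         , inj₂ (vl , _) | (_ , q≢v) , inj₁ lq′ =
        contradiction (leaf eq′ lq′ (adjacent-sym vl)) q≢v
      ... | _   | _         , inj₂ (vl , vp) | _   , inj₂ (_ , vq) with degree-≤2 vl vp (loopless lp) vq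
      ...   | inj₁ q≡l = contradiction (sym q≡l) (loopless lq)
      ...   | inj₂ q≡p = sym q≡p

      bypass-spans : ∀ {p q} → Adjacent D′.edges p q →
                     ∀ x → ∃ λ l → D′.label x ≡ just l × Connected D′.edges p l
      bypass-spans {p} s x rewrite label≡ = 
        let (p≢v , _) , origin = adjacent⁻ s
            l , eq , c = spans (proj₂ (neighbour origin)) x
        in l , eq , bypass-connected⁺ bypass p≢v (label≢v eq) c
        where
        neighbour : ∀ {q} → Adjacent edges p q ⊎ (Adjacent edges v p × Adjacent edges v q) →
                    ∃ (Adjacent edges p)
        neighbour (inj₁ pq)       = _ , pq
        neighbour (inj₂ (vp , _)) = _ , adjacent-sym vp

      bypass-invariant : AllPairs NotParallel D′.edges → Invariant D′
      bypass-invariant np = record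
        { bridges = bypass-bridges ; noParallels = np ; leaf = bypass-leaf ; spans = bypass-spans }

      private
        some-label : ∀ {p q} → Adjacent edges p q → ∀ x → ∃ λ l → label x ≡ just l
        some-label pq x = let l , eq , _ = spans pq x in l , eq

        label′ : ∀ {x l} → label x ≡ just l → D′.label x ≡ just l
        label′ = trans (cong (λ L → L _) label≡)

      side-old : ∀ {x y} → Adjacent edges x y → x ≢ v → y ≢ v → side D′ x y ≡ side D x y
      side-old {x} {y} xy x≢v y≢v = ⊆-antisym
        (λ {z} z∈ → let l , eq = some-label xy z in
          ∈-side⁺ D eq (bypass-connected⁻ b (∈-side⁻ D′ (label′ eq) z∈)))
        (λ {z} z∈ → let l , eq = some-label xy z in
          ∈-side⁺ D′ (label′ eq) (bypass-connected⁺ b x≢v (label≢v eq) (∈-side⁻ D eq z∈)))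
        where b = bypass-removeEdge bypass bridges xy x≢v y≢v

      -- A walk from x without the bridge xv never reaches v, so its edges survive in `D′`; none of
      -- them is xy, which would close a triangle with v. The converse is `bypass-removeNew`.
      side-new : ∀ {x y} → Adjacent edges v x → Adjacent edges v y → x ≢ y → side D′ x y ≡ side D x v
      side-new {x} {y} vx vy x≢y = ⊆-antisym
        (λ {z} z∈ → let l , eq = some-label vx z in
          ∈-side⁺ D eq (connected-mono (removeEdge-comm {E = edges})
            (bypass-removeNew vx vy x≢y (∈-side⁻ D′ (label′ eq) z∈))))
        (λ {z} z∈ → let l , eq = some-label vx z in
          ∈-side⁺ D′ (label′ eq) (avoid ε (∈-side⁻ D eq z∈)))
        where
        avoid : ∀ {p l} → Connected (removeEdge x v edges) x p → Connected (removeEdge x v edges) p l →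
                Connected (removeEdge x y D′.edges) p l
        avoid xp ε = ε
        avoid {p} xp (_◅_ {j = q} s ss) =
          let s′ , _ = adjacent-removeEdge⁻ {E = edges} s in
          adjacent-removeEdge⁺
            (λ { (inj₁ refl) → bridges⇒no-triangle bridges vx vy s′
               ; (inj₂ refl) → bridges⇒no-triangle bridges vy vx s′ })
            (old s′ (λ { refl → bridges (adjacent-sym vx) xp })
                    (λ { refl → bridges (adjacent-sym vx) (xp ◅◅ s ◅ ε) })) ◅
          avoid (xp ◅◅ s ◅ ε) ss

-- Counting by filters, and the effect of one rewriting step

module _ {A : Set} {P Q : A → Set} (P? : Decidable P) (Q? : Decidable Q) where

  length-filter-mono : ∀ xs → (∀ {x} → x ∈ xs → P x → Q x) → length (filter P? xs) ≤ length (filter Q? xs)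
  length-filter-mono [] P⇒Q = z≤n
  length-filter-mono (x ∷ xs) P⇒Q with length-filter-mono xs (P⇒Q ∘ there) | P? x | Q? x
  ... | ih | yes _ | yes _ = s≤s ih
  ... | ih | yes p | no ¬q = contradiction (P⇒Q (here refl) p) ¬q
  ... | ih | no _  | yes _ = ℕ.m≤n⇒m≤1+n ih
  ... | ih | no _  | no _  = ih

  length-filter-mono-< : ∀ {xs} → (∀ {x} → x ∈ xs → P x → Q x) → ∀ {y} → y ∈ xs → ¬ P y → Q y →
                         suc (length (filter P? xs)) ≤ length (filter Q? xs)
  length-filter-mono-< {x ∷ xs} P⇒Q (here refl) ¬Py Qy
    rewrite filter-reject P? {x} {xs} ¬Py | filter-accept Q? {x} {xs} Qy =
    s≤s (length-filter-mono xs (P⇒Q ∘ there))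
  length-filter-mono-< {x ∷ xs} P⇒Q (there y∈) ¬Py Qy
    with length-filter-mono-< (P⇒Q ∘ there) y∈ ¬Py Qy | P? x | Q? x
  ... | ih | yes _ | yes _ = s≤s ih
  ... | ih | yes p | no ¬q = contradiction (P⇒Q (here refl) p) ¬q
  ... | ih | no _  | yes _ = ℕ.m≤n⇒m≤1+n ih
  ... | ih | no _  | no _  = ih

filter-filter : ∀ {A : Set} {P Q : A → Set} (P? : Decidable P) (Q? : Decidable Q) xs →
                filter P? (filter Q? xs) ≡ filter (λ x → Q? x ×-dec P? x) xs
filter-filter P? Q? [] = refl
filter-filter P? Q? (x ∷ xs) with does (Q? x)
... | false = filter-filter P? Q? xs
... | true with does (P? x)
...   | true  = cong (x ∷_) (filter-filter P? Q? xs)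
...   | false = filter-filter P? Q? xs

module _ {N : Set} ⦃ dec : IsDecEquivalence {A = N} _≡_ ⦄ where

  avoids? : ∀ (v : N) → Decidable (λ ((x , y) : N × N) → x ≢ v × y ≢ v)
  avoids? v (x , y) = ¬? (x ≟ v) ×-dec ¬? (y ≟ v)

  module _ (G : Graph N) {v : N} where
    open Graph G

    adjacent-deleteNode⁺ : ∀ {p q} → Adjacent edges p q → p ≢ v → q ≢ v →
                           Adjacent (Graph.edges (deleteNode v G)) p q
    adjacent-deleteNode⁺ pq p≢v q≢v =
      adjacent-filter⁺ (avoids? v) (λ { (inj₁ refl) → p≢v , q≢v ; (inj₂ refl) → q≢v , p≢v }) pq

    adjacent-deleteNode⁻ : ∀ {p q} → Adjacent (Graph.edges (deleteNode v G)) p q →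
                           (p ≢ v × q ≢ v) × Adjacent edges p q
    adjacent-deleteNode⁻ s with adjacent-filter⁻ (avoids? v) {edges} s
    ... | pq , _ , inj₁ refl , ≢v         = ≢v , pq
    ... | pq , _ , inj₂ refl , p≢v , q≢v = (q≢v , p≢v) , pq

module _ {n : ℕ} {N : Set} ⦃ dec : IsDecEquivalence {A = N} _≡_ ⦄
         {f : Subset n → ℕ} (conn : IsConnectivityFunction f) where

  -- The widths of the edges of D′ form a sub-multiset of those of D.
  NoNewWidths : LabelledGraph n N → LabelledGraph n N → Set₁
  NoNewWidths D D′ = ∀ {Q : ℕ → Set} (Q? : Decidable Q) →
    length (filter (Q? ∘ edgeWidth f D′) (LabelledGraph.edges D′)) ≤
    length (filter (Q? ∘ edgeWidth f D) (LabelledGraph.edges D))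

  -- Both steps are bypasses of v, and surviving edges keep their sides. The edge added by a
  -- suppression has the width of the deleted edge va, so the two are matched in the count.
  step-invariant : ∀ {D D′ : LabelledGraph n N} → Invariant D → D ⟶ D′ → Invariant D′ × NoNewWidths D D′
  step-invariant {D} {D′} I (delete {v} {a} _ nbrs unlabelled) =
    bypass-invariant I bypass refl unlabelled degree-≤2 loopless (AllPairs.filter⁺ (avoids? v) noParallels) ,
    λ {Q} Q? → subst (_≤ length (filter (Q? ∘ edgeWidth f D) edges))
      (sym (cong length (filter-filter (Q? ∘ edgeWidth f D′) (avoids? v) edges)))
      (length-filter-mono (λ e → avoids? v e ×-dec Q? (edgeWidth f D′ e)) (Q? ∘ edgeWidth f D) edges
        λ { {x , y} e∈ ((x≢v , y≢v) , q) → subst Q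
          (cong f (side-old {D′ = D′} I bypass refl unlabelled degree-≤2 loopless (∈⇒adjacent e∈) x≢v y≢v)) q })
    where
    open LabelledGraph D
    open Invariant I
    only : ∀ {p} → Adjacent edges v p → p ≡ a
    only {p} vp with subst (p ∈_) nbrs (∈-neighbours⁺ vp)
    ... | here p≡a = p≡a
    E′ = LabelledGraph.edges D′
    bypass : Bypass edges E′ v
    bypass = record
      { irreflexive = λ vv → bridges⇒≢ bridges vv refl
      ; old         = adjacent-deleteNode⁺ graph
      ; through     = λ vp vq → inj₁ (trans (only vp) (sym (only vq)))
      ; adjacent⁻   = λ s → let ≢v , pq = adjacent-deleteNode⁻ graph s in ≢v , inj₁ pq
      }
    degree-≤2 : ∀ {p q r} → Adjacent edges v p → Adjacent edges v q → p ≢ q →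
                Adjacent edges v r → r ≡ p ⊎ r ≡ q
    degree-≤2 vp vq p≢q _ = contradiction (trans (only vp) (sym (only vq))) p≢q
    loopless : ∀ {p q} → Adjacent E′ p q → p ≢ q
    loopless s = bridges⇒≢ bridges (proj₂ (adjacent-deleteNode⁻ graph s))
  step-invariant {D} {D′} I (suppress {v} {a} {b} _ nbrs) =
    bypass-invariant I bypass refl unlabelled degree-≤2 loopless
      (All.tabulate (λ { {x , y} e∈ j → bridges⇒no-triangle bridges va vb
          (proj₂ (adjacent-deleteNode⁻ graph (lose e∈ (joins-sym j)))) })
        ∷ AllPairs.filter⁺ (avoids? v) noParallels) ,
    noNew
    where
    open LabelledGraph D
    open Invariant I
    only : ∀ {p} → Adjacent edges v p → p ≡ a ⊎ p ≡ b
    only {p} vp with subst (p ∈_) nbrs (∈-neighbours⁺ vp)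
    ... | here p≡a         = inj₁ p≡a
    ... | there (here p≡b) = inj₂ p≡b
    va : Adjacent edges v a
    va = ∈-neighbours⁻ (subst (a ∈_) (sym nbrs) (here refl))
    vb : Adjacent edges v b
    vb = ∈-neighbours⁻ (subst (b ∈_) (sym nbrs) (there (here refl)))
    v≢ : ∀ {p} → Adjacent edges v p → p ≢ v
    v≢ vp p≡v = bridges⇒≢ bridges vp (sym p≡v)
    a≢b : a ≢ b
    a≢b with subst Unique nbrs (neighbours-unique noParallels v)
    ... | (a≢b ∷ []) ∷ _ = a≢b
    joins-sym : ∀ {p q x y : N} → Joins (p , q) x y → Joins (x , y) p q
    joins-sym (inj₁ refl) = inj₁ refl
    joins-sym (inj₂ refl) = inj₂ refl
    E′ = LabelledGraph.edges D′
    bypass : Bypass edges E′ v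
    bypass = record
      { irreflexive = λ vv → v≢ vv refl
      ; old         = λ pq p≢v q≢v → there (adjacent-deleteNode⁺ graph pq p≢v q≢v)
      ; through     = λ vp vq → case (only vp , only vq) of λ
          { (inj₁ refl , inj₁ refl) → inj₁ refl
          ; (inj₁ refl , inj₂ refl) → inj₂ (here (inj₁ refl))
          ; (inj₂ refl , inj₁ refl) → inj₂ (here (inj₂ refl))
          ; (inj₂ refl , inj₂ refl) → inj₁ refl }
      ; adjacent⁻   = λ
          { (here (inj₁ refl)) → (v≢ va , v≢ vb) , inj₂ (va , vb)
          ; (here (inj₂ refl)) → (v≢ vb , v≢ va) , inj₂ (vb , va)
          ; (there s) → let ≢v , pq = adjacent-deleteNode⁻ graph s in ≢v , inj₁ pq }
      }
    -- A labelled node has at most one neighbour, whereas v has two distinct ones.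
    unlabelled : ∀ x → label x ≢ just v
    unlabelled x eq = a≢b (leaf eq va vb)
    degree-≤2 : ∀ {p q r} → Adjacent edges v p → Adjacent edges v q → p ≢ q →
                Adjacent edges v r → r ≡ p ⊎ r ≡ q
    degree-≤2 vp vq p≢q vr with only vp | only vq | only vr
    ... | inj₁ refl | inj₁ refl | _      = contradiction refl p≢q
    ... | inj₂ refl | inj₂ refl | _      = contradiction refl p≢q
    ... | inj₁ refl | inj₂ refl | r∈     = r∈
    ... | inj₂ refl | inj₁ refl | r∈     = Sum.swap r∈
    loopless : ∀ {p q} → Adjacent E′ p q → p ≢ q
    loopless (here (inj₁ refl)) = a≢b
    loopless (here (inj₂ refl)) = a≢b ∘ sym
    loopless (there s) = bridges⇒≢ bridges (proj₂ (adjacent-deleteNode⁻ graph s))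
    noNew : NoNewWidths D D′
    noNew {Q} Q? = cons-≤
      where
      Q′? = Q? ∘ edgeWidth f D′
      E₀ = filter (avoids? v) edges
      QE? = Q? ∘ edgeWidth f D
      old-Q : ∀ {e} → e ∈ edges → (proj₁ e ≢ v × proj₂ e ≢ v) × Q (edgeWidth f D′ e) → Q (edgeWidth f D e)
      old-Q e∈ ((x≢v , y≢v) , q) = subst Q
          (cong f (side-old {D′ = D′} I bypass refl unlabelled degree-≤2 loopless (∈⇒adjacent e∈) x≢v y≢v)) q
      E₀≡ : filter Q′? E₀ ≡ filter (λ e → avoids? v e ×-dec Q′? e) edges
      E₀≡ = filter-filter Q′? (avoids? v) edges
      cons-≤ : length (filter Q′? ((a , b) ∷ E₀)) ≤ length (filter QE? edges)
      cons-≤ with Q′? (a , b)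
      ... | no ¬q = subst (λ xs → length xs ≤ length (filter QE? edges)) (sym E₀≡)
        (length-filter-mono (λ e → avoids? v e ×-dec Q′? e) QE? edges old-Q)
      -- The new edge is paid for by the old edge between v and a: it satisfies Q as well, but does
      -- not avoid v.
      ... | yes q with find va
      ...   | e , e∈ , j = subst (λ xs → suc (length xs) ≤ length (filter QE? edges)) (sym E₀≡)
        (length-filter-mono-< (λ e → avoids? v e ×-dec Q′? e) QE? old-Q e∈ (¬avoids j)
          (subst Q (trans (cong f (side-new {D′ = D′} I bypass refl unlabelled degree-≤2 loopless va vb a≢b))
            (sym (edgeWidth-joins I conn (adjacent-sym va) (joins-comm j)))) q))
        where
        ¬avoids : ∀ {e} → Joins e v a → ¬ ((proj₁ e ≢ v × proj₂ e ≢ v) × Q (edgeWidth f D′ e))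
        ¬avoids (inj₁ refl) ((≢v , _) , _) = ≢v refl
        ¬avoids (inj₂ refl) ((_ , ≢v) , _) = ≢v refl

  steps-noNewWidths : ∀ {D D′ : LabelledGraph n N} → Invariant D → Star _⟶_ D D′ → NoNewWidths D D′
  steps-noNewWidths I ε        Q? = ℕ.≤-refl
  steps-noNewWidths I (s ◅ ss) Q? with step-invariant I s
  ... | I′ , le = ℕ.≤-trans (steps-noNewWidths I′ ss Q?) (le Q?)

-- Simple paths; every edge of a tree is a bridge

module _ {N : Set} (R : N → N → Set) (y : N) where

  data Path : List N → Set where
    [-] : Path (y ∷ [])
    _∷_ : ∀ {p q xs} → R p q → Path (q ∷ xs) → Path (p ∷ q ∷ xs)

module _ {N : Set} {R : N → N → Set} {y : N} where

  suffix-from : ∀ {p xs} → p ∈ xs → Path R y xs → Unique xs → ∃ λ ys → Path R y (p ∷ ys) × Unique (p ∷ ys)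
  suffix-from (here refl) π        u       = _ , π , u
  suffix-from (there p∈)  (_ ∷ π)  (_ ∷ u) = suffix-from p∈ π u

  path-snoc : ∀ {S : N → N → Set} → (∀ {p q} → R p q → S p q) →
              ∀ {xs z} → Path R y xs → S y z → Linked S (xs ∷ʳ z)
  path-snoc R⇒S [-]     s = s ∷ [-]
  path-snoc R⇒S (r ∷ π) s = R⇒S r ∷ path-snoc R⇒S π s

module _ {N : Set} ⦃ dec : IsDecEquivalence {A = N} _≡_ ⦄ where

  -- Loop erasure: when the start recurs on the path already built, keep only the suffix from that
  -- recurrence.
  simple-path : ∀ {R : N → N → Set} {p y} → Star R p y → ∃ λ xs → Path R y (p ∷ xs) × Unique (p ∷ xs)
  simple-path ε = [] , [-] , ([] ∷ [])
  simple-path {p = p} (s ◅ ss) with simple-path ss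
  ... | xs , π , u with Any.any? (p ≟_) (_ ∷ xs)
  ...   | yes p∈ = suffix-from p∈ π u
  ...   | no  p∉ = _ , s ∷ π , (All.¬Any⇒All¬ _ p∉ ∷ u)

  -- Make a detour around xy simple. With no edge it makes xy a loop, with one edge it is the
  -- removed edge, and otherwise xy closes it to a cycle.
  tree-bridges : ∀ {G : Graph N} → IsTree G → Bridges (Graph.edges G)
  tree-bridges {G} tree {x} {y} xy c with simple-path c
  ... | [] , [-] , _ with find xy
  ...   | _ , e∈ , inj₁ refl = All.lookup (IsSimple.noLoops (IsTree.isSimple tree)) e∈ refl
  ...   | _ , e∈ , inj₂ refl = All.lookup (IsSimple.noLoops (IsTree.isSimple tree)) e∈ refl
  tree-bridges {G} tree {x} {y} xy c | _ ∷ [] , (xw ∷ [-]) , _ =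
    proj₂ (adjacent-removeEdge⁻ {E = Graph.edges G} xw) (inj₁ refl)
  tree-bridges {G} tree {x} {y} xy c | xs@(_ ∷ _ ∷ _) , π , u = IsTree.acyclic tree x xs
    (s≤s (s≤s z≤n) , u , path-snoc (proj₁ ∘ adjacent-removeEdge⁻ {E = Graph.edges G}) π (adjacent-sym xy))

  length≡1⇒unique : ∀ {A : Set} {xs : List A} {a b} → length xs ≡ 1 → a ∈ xs → b ∈ xs → a ≡ b
  length≡1⇒unique {xs = _ ∷ []} _ (here refl) (here refl) = refl

  branchDecomposition-invariant : ∀ {n} {D : LabelledGraph n N} → IsBranchDecomposition D → Invariant D
  branchDecomposition-invariant {D = D} isBD = record
    { bridges     = tree-bridges isTree
    ; noParallels = noParallels
    ; leaf        = λ {x} eq lp lq → let l , eq′ , (_ , deg) = label-leaf x in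
        leaf′ (just-injective (trans (sym eq′) eq)) deg lp lq
    ; spans       = λ pq x → let l , eq , (l∈ , _) = label-leaf x in l , eq , connected (endpoint pq) l∈
    }
    where
    open LabelledGraph D
    open IsBranchDecomposition isBD
    open IsTree isTree
    open IsSimple isSimple
    leaf′ : ∀ {l l′ p q} → l ≡ l′ → degree graph l ≡ 1 → Adjacent edges l′ p → Adjacent edges l′ q → p ≡ q
    leaf′ refl deg lp lq = length≡1⇒unique deg (∈-neighbours⁺ lp) (∈-neighbours⁺ lq)
    endpoint : ∀ {p q} → Adjacent edges p q → p ∈ nodes
    endpoint pq with find pq
    ... | _ , e∈ , inj₁ refl = proj₁ (All.lookup endpoints e∈)
    ... | _ , e∈ , inj₂ refl = proj₂ (All.lookup endpoints e∈)

-- Sides, bridges and the invariant in the glued graph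

module _ {n : ℕ} {N : Set} ⦃ dec : IsDecEquivalence {A = N} _≡_ ⦄
         {D : LabelledGraph n N} (I : Invariant D)
         {u v : N} (uv : Adjacent (LabelledGraph.edges D) u v)
         (c : Colouring {n}) where
  open LabelledGraph D
  open Invariant I

  private
    F = removeEdge u v edges
    G = glued D u v (part c)
    module G = LabelledGraph G

  block : Fin 3 → List (RefinedNode N × RefinedNode N)
  block i = (centre , subdiv i) ∷ (copy i u , subdiv i) ∷ (subdiv i , copy i v) ∷
            map (λ (x , y) → copy i x , copy i y) F

  -- Adjacency of the glued graph with both orientations as constructors, so that closure of a node
  -- set can be checked by pattern matching.
  data Glued : RefinedNode N → RefinedNode N → Set where
    centre-subdiv : ∀ {i} → Glued centre (subdiv i)
    subdiv-centre : ∀ {i} → Glued (subdiv i) centre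
    u-subdiv      : ∀ {i} → Glued (copy i u) (subdiv i)
    subdiv-u      : ∀ {i} → Glued (subdiv i) (copy i u)
    v-subdiv      : ∀ {i} → Glued (copy i v) (subdiv i)
    subdiv-v      : ∀ {i} → Glued (subdiv i) (copy i v)
    copied        : ∀ {i p q} → Adjacent F p q → Glued (copy i p) (copy i q)

  adjacent⇒glued : ∀ {z w} → Adjacent G.edges z w → Glued z w
  adjacent⇒glued zw with find zw
  ... | e , e∈ , j with find (∈-concatMap⁻ block {xs = allFin 3} e∈)
  ...   | i , _ , e∈i with e∈i | j
  ...     | here refl                 | inj₁ refl = centre-subdiv
  ...     | here refl                 | inj₂ refl = subdiv-centre
  ...     | there (here refl)         | inj₁ refl = u-subdiv
  ...     | there (here refl)         | inj₂ refl = subdiv-u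
  ...     | there (there (here refl)) | inj₁ refl = subdiv-v
  ...     | there (there (here refl)) | inj₂ refl = v-subdiv
  ...     | there (there (there e∈))  | j with ∈-map⁻ _ e∈
  ...       | _ , e∈F , refl with j
  ...         | inj₁ refl = copied (∈⇒adjacent e∈F)
  ...         | inj₂ refl = copied (adjacent-sym (∈⇒adjacent e∈F))

  private
    in-block : ∀ i {e} → e ∈ block i → e ∈ G.edges
    in-block i e∈ = ∈-concatMap⁺ block (lose (∈-allFin i) e∈)

  glued⇒adjacent : ∀ {z w} → Glued z w → Adjacent G.edges z w
  glued⇒adjacent (centre-subdiv {i}) = ∈⇒adjacent (in-block i (here refl))
  glued⇒adjacent (subdiv-centre {i}) = adjacent-sym (∈⇒adjacent (in-block i (here refl)))
  glued⇒adjacent (u-subdiv {i})      = ∈⇒adjacent (in-block i (there (here refl)))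
  glued⇒adjacent (subdiv-u {i})      = adjacent-sym (∈⇒adjacent (in-block i (there (here refl))))
  glued⇒adjacent (v-subdiv {i})      = adjacent-sym (∈⇒adjacent (in-block i (there (there (here refl)))))
  glued⇒adjacent (subdiv-v {i})      = ∈⇒adjacent (in-block i (there (there (here refl))))
  glued⇒adjacent (copied {i} pq) with find pq
  ... | _ , e∈ , inj₁ refl = ∈⇒adjacent (in-block i (there (there (there (∈-map⁺ _ e∈)))))
  ... | _ , e∈ , inj₂ refl = adjacent-sym (∈⇒adjacent (in-block i (there (there (there (∈-map⁺ _ e∈))))))

  glued-label : ∀ {x l} → label x ≡ just l → G.label x ≡ just (copy (c x) l)
  glued-label {x} eq rewrite part-lookup c 0F x | part-lookup c 1F x | part-lookup c 2F x | eq with c x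
  ... | 0F = refl
  ... | 1F = refl
  ... | 2F = refl

  private
    u≢v : u ≢ v
    u≢v = bridges⇒≢ bridges uv

    connected-u : ∀ x → ∃ λ l → label x ≡ just l × Connected edges u l
    connected-u = spans uv

  module _ {z w : RefinedNode N} (P : RefinedNode N → Set) (Pz : P z)
           (closed : ∀ {y y′} → Glued y y′ → ¬ Joins (y , y′) z w → P y → P y′) where

    invariant-step : ∀ {y y′} → Adjacent (removeEdge z w G.edges) y y′ → P y → P y′
    invariant-step s Py with adjacent-removeEdge⁻ {E = G.edges} s
    ... | s′ , ¬j = closed (adjacent⇒glued s′) ¬j Py

    invariant-bridge : ¬ P w → ¬ Connected (removeEdge z w G.edges) z w
    invariant-bridge ¬Pw c = ¬Pw (connected-invariant P invariant-step c Pz)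

    -- P describes the component of z once zw is removed: closure under the other edges bounds the
    -- component from above, and `reach` bounds it from below.
    glued-side : (∀ {y} → P y → Connected (removeEdge z w G.edges) z y) →
                 ∀ {X} → (∀ {x l} → label x ≡ just l → x Subset.∈ X → P (copy (c x) l)) →
                 (∀ {x l} → label x ≡ just l → P (copy (c x) l) → x Subset.∈ X) →
                 side G z w ≡ X
    glued-side reach X⇒P P⇒X = ⊆-antisym
      (λ {x} x∈ → let l , eq , _ = connected-u x in
        P⇒X eq (connected-invariant P invariant-step (∈-side⁻ G (glued-label eq) x∈) Pz))
      (λ {x} x∈ → let l , eq , _ = connected-u x in
        ∈-side⁺ G (glued-label eq) (reach (X⇒P eq x∈)))

  module _ (i : Fin 3) where

    -- The component of `subdiv i` without its edge to the centre. Reachability from u is part of it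
    -- because the invariant does not make the whole of T connected.
    InCopy : RefinedNode N → Set
    InCopy (copy j p) = j ≡ i × Connected edges u p
    InCopy (subdiv j) = j ≡ i
    InCopy centre     = Empty.⊥

    private
      closed : ∀ {y y′} → Glued y y′ → ¬ Joins (y , y′) (subdiv i) centre → InCopy y → InCopy y′
      closed centre-subdiv ¬j ()
      closed subdiv-centre ¬j refl = contradiction (inj₁ refl) ¬j
      closed u-subdiv ¬j (refl , _) = refl
      closed subdiv-u ¬j refl = refl , ε
      closed v-subdiv ¬j (refl , _) = refl
      closed subdiv-v ¬j refl = refl , uv ◅ ε
      closed (copied pq) ¬j (refl , c) = refl , c ◅◅ proj₁ (adjacent-removeEdge⁻ {E = edges} pq) ◅ ε

      R = removeEdge (subdiv i) centre G.edges

      kept : ∀ {y y′} → Glued y y′ → y ≢ centre → y′ ≢ centre → Adjacent R y y′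
      kept s y≢ y′≢ = adjacent-removeEdge⁺ {x = subdiv i} {y = centre}
        (λ { (inj₁ refl) → y′≢ refl ; (inj₂ refl) → y≢ refl }) (glued⇒adjacent s)

      -- Every edge of T is copied except uv, whose copy is the path of two edges through
      -- `subdiv i`.
      lift : ∀ {p q} → Adjacent edges p q → Connected R (copy i p) (copy i q)
      lift {p} {q} pq with joins? (p , q) u v
      ... | yes (inj₁ refl) = kept u-subdiv (λ ()) (λ ()) ◅ kept subdiv-v (λ ()) (λ ()) ◅ ε
      ... | yes (inj₂ refl) = kept v-subdiv (λ ()) (λ ()) ◅ kept subdiv-u (λ ()) (λ ()) ◅ ε
      ... | no ¬j = kept (copied (adjacent-removeEdge⁺ ¬j pq)) (λ ()) (λ ()) ◅ ε

      reach : ∀ {y} → InCopy y → Connected R (subdiv i) y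
      reach {copy _ p} (refl , c) = kept subdiv-u (λ ()) (λ ()) ◅ kleisliStar (copy i) lift c
      reach {subdiv _} refl = ε

    centre-bridge : ¬ Connected R (subdiv i) centre
    centre-bridge = invariant-bridge InCopy refl closed λ ()

    centre-side : side G (subdiv i) centre ≡ part c i
    centre-side = glued-side InCopy refl closed reach
      (λ {x} eq x∈ → let l , eq′ , conn = connected-u x in
        x∈part⁻ c x∈ , subst (Connected edges u) (just-injective (trans (sym eq′) eq)) conn)
      (λ eq (cx≡i , _) → x∈part⁺ c cx≡i)

    copy-reaches-centre : ∀ {p} → Connected edges u p → Connected G.edges (copy i p) centre
    copy-reaches-centre conn =
      connected-sym (connected-removeEdge {E = G.edges} {x = subdiv i} {y = centre}
        (reach {copy i _} (refl , conn))) ◅◅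
      glued⇒adjacent (subdiv-centre {i}) ◅ ε

  -- T is F or F minus a copied edge; the hypotheses make the i-th copy of the component of x in T
  -- one side of the edge joining copy i x and w.
  module _ (i : Fin 3) {T : List (N × N)} {x : N} {w : RefinedNode N}
           (leaves : ∀ {p y} → Connected T x p → Glued (copy i p) y → ¬ Joins (copy i p , y) (copy i x) w →
                     ∃ λ q → y ≡ copy i q × Adjacent T p q)
           (stays : ∀ {p q} → Connected T x p → Adjacent T p q →
                    Glued (copy i p) (copy i q) × ¬ Joins (copy i p , copy i q) (copy i x) w) where

    data InBranch : RefinedNode N → Set where
      branch : ∀ {p} → Connected T x p → InBranch (copy i p)

    private
      R = removeEdge (copy i x) w G.edges

      closed : ∀ {y y′} → Glued y y′ → ¬ Joins (y , y′) (copy i x) w → InBranch y → InBranch y′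
      closed s ¬j (branch xp) with leaves xp s ¬j
      ... | q , refl , pq = branch (xp ◅◅ pq ◅ ε)

      reach-from : ∀ {p q} → Connected T x p → Connected T p q → Connected R (copy i p) (copy i q)
      reach-from xp ε = ε
      reach-from xp (s ◅ ss) with stays xp s
      ... | g , ¬j = adjacent-removeEdge⁺ ¬j (glued⇒adjacent g) ◅ reach-from (xp ◅◅ s ◅ ε) ss

    branch-bridge : ¬ InBranch w → ¬ Connected R (copy i x) w
    branch-bridge = invariant-bridge InBranch (branch ε) closed

    branch-side : ∀ {X} → (∀ {y l} → label y ≡ just l → y Subset.∈ X → Connected T x l) →
                  (∀ {y l} → label y ≡ just l → Connected T x l → y Subset.∈ X) →
                  side G (copy i x) w ≡ X ∩ part c i
    branch-side {X} X⇒T T⇒X = glued-side InBranch (branch ε) closed (λ { (branch xp) → reach-from ε xp })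
      (λ {y} {l} eq y∈ → let y∈X , y∈i = x∈p∩q⁻ X (part c i) y∈ in
        subst (λ j → InBranch (copy j l)) (sym (x∈part⁻ c y∈i)) (branch (X⇒T eq y∈X)))
      (λ { eq b → x∈p∩q⁺ (unbranch eq b) })
      where
      unbranch : ∀ {y l} → label y ≡ just l → InBranch (copy (c y) l) → y Subset.∈ X × y Subset.∈ part c i
      unbranch {y} eq b with c y in cy | b
      ... | _ | branch xl = T⇒X eq xl , x∈part⁺ c cy

  private
    F⇒E : ∀ {p q} → Adjacent F p q → Adjacent edges p q
    F⇒E = proj₁ ∘ adjacent-removeEdge⁻ {E = edges}

    joins-copy⁺ : ∀ {i} {p q x y : N} → Joins (p , q) x y → Joins (copy i p , copy i q) (copy i x) (copy i y)
    joins-copy⁺ (inj₁ refl) = inj₁ refl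
    joins-copy⁺ (inj₂ refl) = inj₂ refl

    joins-copy⁻ : ∀ {i} {p q x y : N} → Joins (copy i p , copy i q) (copy i x) (copy i y) → Joins (p , q) x y
    joins-copy⁻ (inj₁ refl) = inj₁ refl
    joins-copy⁻ (inj₂ refl) = inj₂ refl

  module U (i : Fin 3) where

    leaves : ∀ {p y} → Connected F u p → Glued (copy i p) y → ¬ Joins (copy i p , y) (copy i u) (subdiv i) →
             ∃ λ q → y ≡ copy i q × Adjacent F p q
    leaves up u-subdiv    ¬j = contradiction (inj₁ refl) ¬j
    -- Leaving the branch at the copy of v would require v on the side of u, but uv is a bridge.
    leaves up v-subdiv    ¬j = contradiction up (bridges uv)
    leaves up (copied pq) ¬j = _ , refl , pq

    stays : ∀ {p q} → Connected F u p → Adjacent F p q →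
            Glued (copy i p) (copy i q) × ¬ Joins (copy i p , copy i q) (copy i u) (subdiv i)
    stays up pq = copied pq , λ { (inj₁ ()) ; (inj₂ ()) }

    u-bridge : ¬ Connected (removeEdge (copy i u) (subdiv i) G.edges) (copy i u) (subdiv i)
    u-bridge = branch-bridge i leaves stays λ ()

    u-side : side G (copy i u) (subdiv i) ≡ side D u v ∩ part c i
    u-side = branch-side i leaves stays (∈-side⁻ D) (∈-side⁺ D)

  module V (i : Fin 3) where

    leaves : ∀ {p y} → Connected F v p → Glued (copy i p) y → ¬ Joins (copy i p , y) (copy i v) (subdiv i) →
             ∃ λ q → y ≡ copy i q × Adjacent F p q
    leaves vp u-subdiv    ¬j = contradiction (connected-sym vp) (bridges uv)
    leaves vp v-subdiv    ¬j = contradiction (inj₁ refl) ¬j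
    leaves vp (copied pq) ¬j = _ , refl , pq

    stays : ∀ {p q} → Connected F v p → Adjacent F p q →
            Glued (copy i p) (copy i q) × ¬ Joins (copy i p , copy i q) (copy i v) (subdiv i)
    stays vp pq = copied pq , λ { (inj₁ ()) ; (inj₂ ()) }

    v-bridge : ¬ Connected (removeEdge (copy i v) (subdiv i) G.edges) (copy i v) (subdiv i)
    v-bridge = branch-bridge i leaves stays λ ()

    v-side : side G (copy i v) (subdiv i) ≡ side D v u ∩ part c i
    v-side = branch-side i leaves stays
      (λ eq y∈ → connected-mono (removeEdge-comm {E = edges}) (∈-side⁻ D eq y∈))
      (λ eq vl → ∈-side⁺ D eq (connected-mono (removeEdge-comm {E = edges}) vl))

  module Away {x y : N} (xy : Adjacent F x y) (¬xu : ¬ Connected (removeEdge x y edges) x u) where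

    private
      T = removeEdge x y edges

      -- The edge uv differs from xy and so survives in T; reaching v would mean reaching u.
      ¬xv : ¬ Connected T x v
      ¬xv xv = ¬xu (xv ◅◅ adjacent-removeEdge⁺ vu-not-xy (adjacent-sym uv) ◅ ε)
        where
        vu-not-xy : ¬ Joins (v , u) x y
        vu-not-xy (inj₁ refl) = proj₂ (adjacent-removeEdge⁻ {E = edges} xy) (inj₂ refl)
        vu-not-xy (inj₂ refl) = proj₂ (adjacent-removeEdge⁻ {E = edges} xy) (inj₁ refl)

      T⇒F : ∀ {p q} → Connected T x p → Adjacent T p q → Adjacent F p q
      T⇒F xp pq = adjacent-removeEdge⁺ (λ { (inj₁ refl) → ¬xu xp ; (inj₂ refl) → ¬xv xp })
        (proj₁ (adjacent-removeEdge⁻ {E = edges} pq))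

      T⇒F* : ∀ {p q} → Connected T x p → Connected T p q → Connected F p q
      T⇒F* xp ε        = ε
      T⇒F* xp (s ◅ ss) = T⇒F xp s ◅ T⇒F* (xp ◅◅ s ◅ ε) ss

    module _ (i : Fin 3) where

      leaves : ∀ {p z} → Connected T x p → Glued (copy i p) z → ¬ Joins (copy i p , z) (copy i x) (copy i y) →
               ∃ λ q → z ≡ copy i q × Adjacent T p q
      leaves xp u-subdiv    ¬j = contradiction xp ¬xu
      leaves xp v-subdiv    ¬j = contradiction xp ¬xv
      leaves xp (copied pq) ¬j = _ , refl , adjacent-removeEdge⁺ (¬j ∘ joins-copy⁺) (F⇒E pq)

      stays : ∀ {p q} → Connected T x p → Adjacent T p q →
              Glued (copy i p) (copy i q) × ¬ Joins (copy i p , copy i q) (copy i x) (copy i y)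
      stays xp pq = copied (T⇒F xp pq) , proj₂ (adjacent-removeEdge⁻ {E = edges} pq) ∘ joins-copy⁻

      away-bridge : ¬ Connected (removeEdge (copy i x) (copy i y) G.edges) (copy i x) (copy i y)
      away-bridge = branch-bridge i leaves stays λ { (branch xy′) → bridges (F⇒E xy) xy′ }

      away-side : side G (copy i x) (copy i y) ≡ side D x y ∩ part c i
      away-side = branch-side i leaves stays (∈-side⁻ D) (∈-side⁺ D)

    -- The side of x contains neither u nor v, so its walks do not use uv. It therefore lies in a
    -- single component of F: that of u, giving W, or another one.
    away-homogeneous : side D x y ⊆ side D u v ⊎ side D x y ⊆ ∁ (side D u v)
    away-homogeneous with connected? F u x
    ... | yes ux = inj₁ λ {z} z∈ → let l , eq , _ = connected-u z in
      ∈-side⁺ D eq (ux ◅◅ T⇒F* ε (∈-side⁻ D eq z∈))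
    ... | no ¬ux = inj₂ λ {z} z∈ → let l , eq , _ = connected-u z in x∉p⇒x∈∁p λ z∈W →
      ¬ux (∈-side⁻ D eq z∈W ◅◅ connected-sym (T⇒F* ε (∈-side⁻ D eq z∈)))

  -- Provides the orientation required by `Away`: if both ends reached u without xy, then xy would
  -- not be a bridge.
  some-endpoint-away : ∀ {x y} → Adjacent F x y →
    ¬ Connected (removeEdge x y edges) x u ⊎ ¬ Connected (removeEdge y x edges) y u
  some-endpoint-away {x} {y} xy with connected? (removeEdge x y edges) x u
  ... | no ¬xu = inj₁ ¬xu
  ... | yes xu = inj₂ λ yu → bridges (F⇒E xy)
    (xu ◅◅ connected-sym (connected-mono (removeEdge-comm {E = edges}) yu))

  private
    bridge-swap : ∀ {z w} → ¬ Connected (removeEdge z w G.edges) z w →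
                  ¬ Connected (removeEdge w z G.edges) w z
    bridge-swap {z} {w} ¬c c = ¬c (connected-sym (connected-mono (removeEdge-comm {E = G.edges} {w} {z}) c))

  glued-bridge : ∀ {z w} → Glued z w → ¬ Connected (removeEdge z w G.edges) z w
  glued-bridge (centre-subdiv {i}) = bridge-swap (centre-bridge i)
  glued-bridge (subdiv-centre {i}) = centre-bridge i
  glued-bridge (u-subdiv {i})      = U.u-bridge i
  glued-bridge (subdiv-u {i})      = bridge-swap (U.u-bridge i)
  glued-bridge (v-subdiv {i})      = V.v-bridge i
  glued-bridge (subdiv-v {i})      = bridge-swap (V.v-bridge i)
  glued-bridge (copied {i} xy) with some-endpoint-away xy
  ... | inj₁ ¬xu = Away.away-bridge xy ¬xu i
  ... | inj₂ ¬yu = bridge-swap (Away.away-bridge (adjacent-sym xy) ¬yu i)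

  private
    InBlock : Fin 3 → RefinedNode N → Set
    InBlock i (copy j _) = j ≡ i
    InBlock i (subdiv j) = j ≡ i
    InBlock i centre     = Empty.⊥

    InBlock-unique : ∀ {i j} z → InBlock i z → InBlock j z → i ≡ j
    InBlock-unique (copy _ _) refl refl = refl
    InBlock-unique (subdiv _) refl refl = refl

    block-ends : ∀ {i e} → e ∈ block i → (proj₁ e ≡ centre ⊎ InBlock i (proj₁ e)) × InBlock i (proj₂ e)
    block-ends (here refl)                 = inj₁ refl , refl
    block-ends (there (here refl))         = inj₂ refl , refl
    block-ends (there (there (here refl))) = inj₂ refl , refl
    block-ends (there (there (there e∈))) with ∈-map⁻ _ e∈
    ... | _ , _ , refl = inj₂ refl , refl

    -- The second end of an edge always lies in its own block and is never the centre, so edges of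
    -- different blocks cannot have the same two ends.
    blocks-apart : ∀ {i j} → i ≢ j → All (λ e → All (NotParallel e) (block j)) (block i)
    blocks-apart {i} {j} i≢j = All.tabulate λ {e} e∈i → All.tabulate λ {e′} e′∈j →
      apart (block-ends e∈i) (block-ends e′∈j)
      where
      apart : ∀ {z w z′ w′} → (z ≡ centre ⊎ InBlock i z) × InBlock i w →
              (z′ ≡ centre ⊎ InBlock j z′) × InBlock j w′ → ¬ Joins (z , w) z′ w′
      apart {w = w} (_ , w∈i) (_ , w∈j) (inj₁ refl) = i≢j (InBlock-unique w w∈i w∈j)
      apart (_ , ()) (inj₁ refl , _) (inj₂ refl)
      apart {w = w} (_ , w∈i) (inj₂ w∈j , _) (inj₂ refl) = i≢j (InBlock-unique w w∈i w∈j)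

    block-noParallels : ∀ i → AllPairs NotParallel (block i)
    block-noParallels i =
      ((λ { (inj₁ ()) ; (inj₂ ()) }) ∷ (λ { (inj₁ ()) ; (inj₂ ()) }) ∷
        All.map⁺ (All.tabulate λ { _ (inj₁ ()) ; _ (inj₂ ()) })) ∷
      ((λ { (inj₁ ()) ; (inj₂ refl) → u≢v refl }) ∷ All.map⁺ (All.tabulate λ { _ (inj₁ ()) ; _ (inj₂ ()) })) ∷
      All.map⁺ (All.tabulate λ { _ (inj₁ ()) ; _ (inj₂ ()) }) ∷
      AllPairs.map⁺ (AllPairs.map (λ np → np ∘ joins-copy⁻)
        (AllPairs.filter⁺ (λ e → ¬? (joins? e u v)) noParallels))

  glued-noParallels : AllPairs NotParallel G.edges
  glued-noParallels = AllPairs.concat⁺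
    (All.map⁺ (All.tabulate {xs = allFin 3} λ {i} _ → block-noParallels i))
    (AllPairs.map⁺ (AllPairs.map blocks-apart (allFin⁺ 3)))

  -- If the labelled node is u or v, its only edge in T is uv. F lacks that edge, so `subdiv i` is
  -- the only neighbour of the copy.
  glued-leaf : ∀ {x i l z w} → label x ≡ just l → Glued (copy i l) z → Glued (copy i l) w → z ≡ w
  glued-leaf eq u-subdiv    u-subdiv    = refl
  glued-leaf eq v-subdiv    v-subdiv    = refl
  glued-leaf eq u-subdiv    v-subdiv    = refl
  glued-leaf eq v-subdiv    u-subdiv    = refl
  glued-leaf eq (copied p)  (copied q)  = cong (copy _) (leaf eq (F⇒E p) (F⇒E q))
  glued-leaf eq u-subdiv    (copied q)  = contradiction (inj₁ (cong (u ,_) (leaf eq (F⇒E q) uv)))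
    (proj₂ (adjacent-removeEdge⁻ {E = edges} q))
  glued-leaf eq (copied q)  u-subdiv    = contradiction (inj₁ (cong (u ,_) (leaf eq (F⇒E q) uv)))
    (proj₂ (adjacent-removeEdge⁻ {E = edges} q))
  glued-leaf eq v-subdiv    (copied q)  = contradiction (inj₂ (cong (v ,_) (leaf eq (F⇒E q) (adjacent-sym uv))))
    (proj₂ (adjacent-removeEdge⁻ {E = edges} q))
  glued-leaf eq (copied q)  v-subdiv    = contradiction (inj₂ (cong (v ,_) (leaf eq (F⇒E q) (adjacent-sym uv))))
    (proj₂ (adjacent-removeEdge⁻ {E = edges} q))

  -- The element x links an arbitrary copied edge to u: by `spans` its labelled node is reachable
  -- from both.
  glued-reaches-centre : Fin n → ∀ {z w} → Glued z w → Connected G.edges z centre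
  glued-reaches-centre x centre-subdiv       = ε
  glued-reaches-centre x subdiv-centre       = glued⇒adjacent subdiv-centre ◅ ε
  glued-reaches-centre x subdiv-u            = glued⇒adjacent subdiv-centre ◅ ε
  glued-reaches-centre x subdiv-v            = glued⇒adjacent subdiv-centre ◅ ε
  glued-reaches-centre x (u-subdiv {i})      = copy-reaches-centre i ε
  glued-reaches-centre x (v-subdiv {i})      = copy-reaches-centre i (uv ◅ ε)
  glued-reaches-centre x (copied {i} pq) with connected-u x | spans (F⇒E pq) x
  ... | l , eq , ul | l′ , eq′ , pl′ = copy-reaches-centre i
    (ul ◅◅ connected-sym (subst (Connected edges _) (just-injective (trans (sym eq′) eq)) pl′))

  glued-invariant : Invariant G
  glued-invariant = record
    { bridges     = λ zw → glued-bridge (adjacent⇒glued zw)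
    ; noParallels = glued-noParallels
    ; leaf        = λ {x} eq zw zw′ → let l , eq′ , _ = connected-u x in
        leaf′ eq′ (just-injective (trans (sym eq) (glued-label eq′))) (adjacent⇒glued zw) (adjacent⇒glued zw′)
    ; spans       = λ zw x → let l , eq , ul = connected-u x in
        copy (c x) l , glued-label eq ,
        glued-reaches-centre x (adjacent⇒glued zw) ◅◅ connected-sym (copy-reaches-centre (c x) ul)
    }
    where
    leaf′ : ∀ {x i l y z w} → label x ≡ just l → y ≡ copy i l → Glued y z → Glued y w → z ≡ w
    leaf′ eq refl = glued-leaf eq

-- Counting the edges of width k in the refinement

length-filter-≡0 : ∀ {A : Set} {P : A → Set} (P? : Decidable P) {xs} → length (filter P? xs) ≡ 0 →
                   ∀ {x} → x ∈ xs → ¬ P x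
length-filter-≡0 P? {xs} eq x∈ Px with filter P? xs | ∈-filter⁺ P? x∈ Px
length-filter-≡0 P? () x∈ Px | _ ∷ _ | _

module _ {A B : Set} {P : B → Set} (P? : Decidable P) where

  length-filter-++ : ∀ xs ys → length (filter P? (xs ++ ys)) ≡ length (filter P? xs) + length (filter P? ys)
  length-filter-++ xs ys = trans (cong length (filter-++ P? xs ys)) (length-++ (filter P? xs))

  length-filter-map : ∀ (g : A → B) xs → length (filter P? (map g xs)) ≡ length (filter (P? ∘ g) xs)
  length-filter-map g [] = refl
  length-filter-map g (x ∷ xs) with P? (g x)
  ... | yes _ = cong suc (length-filter-map g xs)
  ... | no _  = length-filter-map g xs

-- The three selected sublists are disjoint and contained in the one selected by Q. Applied to the
-- three copies of each edge, this turns uniqueness of the wide copy into the bound on their number.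
length-filter-exclusive : ∀ {A : Set} {P : Fin 3 → A → Set} {Q : A → Set}
  (P? : ∀ i → Decidable (P i)) (Q? : Decidable Q) xs →
  (∀ {x i} → x ∈ xs → P i x → Q x) → (∀ {x i j} → x ∈ xs → P i x → P j x → i ≡ j) →
  length (filter (P? 0F) xs) + (length (filter (P? 1F) xs) + length (filter (P? 2F) xs)) ≤ length (filter Q? xs)
length-filter-exclusive P? Q? [] P⇒Q excl = z≤n
length-filter-exclusive P? Q? (x ∷ xs) P⇒Q excl
  with length-filter-exclusive P? Q? xs (P⇒Q ∘ there) (excl ∘ there) | P? 0F x | P? 1F x | P? 2F x | Q? x
... | ih | yes p | yes q | _     | _     = contradiction (excl (here refl) p q) λ ()
... | ih | yes p | no _  | yes q | _     = contradiction (excl (here refl) p q) λ ()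
... | ih | no _  | yes p | yes q | _     = contradiction (excl (here refl) p q) λ ()
... | ih | yes p | no _  | no _  | no ¬q = contradiction (P⇒Q (here refl) p) ¬q
... | ih | no _  | yes p | no _  | no ¬q = contradiction (P⇒Q (here refl) p) ¬q
... | ih | no _  | no _  | yes p | no ¬q = contradiction (P⇒Q (here refl) p) ¬q
... | ih | yes _ | no _  | no _  | yes _ = s≤s ih
... | ih | no _  | yes _ | no _  | yes _ = ℕ.≤-trans (ℕ.≤-reflexive (ℕ.+-suc _ _)) (s≤s ih)
... | ih | no _  | no _  | yes _ | yes _ = ℕ.≤-trans
  (ℕ.≤-reflexive (trans (cong (length (filter (P? 0F) xs) +_) (ℕ.+-suc _ _)) (ℕ.+-suc _ _))) (s≤s ih)
... | ih | no _  | no _  | no _  | yes _ = ℕ.m≤n⇒m≤1+n ih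
... | ih | no _  | no _  | no _  | no _  = ih

module _ {n : ℕ} {f : Subset n → ℕ} (conn : IsConnectivityFunction f)
         {N : Set} ⦃ dec : IsDecEquivalence {A = N} _≡_ ⦄
         {D : LabelledGraph n N} (I : Invariant D)
         {u v : N} (uv : Adjacent (LabelledGraph.edges D) u v)
         (c : Colouring {n}) where
  open LabelledGraph D
  open Invariant I

  private
    F = removeEdge u v edges
    G = glued D u v (part c)
    W = side D u v
    I′ = glued-invariant I uv c

  centre-width : ∀ i → edgeWidth f G (centre , subdiv i) ≡ f (part c i)
  centre-width i = trans
    (edgeWidth-comm I′ conn {subdiv i} {centre} (glued⇒adjacent I uv c subdiv-centre))
    (cong f (centre-side I uv c i))

  u-width : ∀ i → edgeWidth f G (copy i u , subdiv i) ≡ f (part c i ∩ W)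
  u-width i = cong f (trans (U.u-side I uv c i) (∩-comm W (part c i)))

  v-width : ∀ i → edgeWidth f G (subdiv i , copy i v) ≡ f (part c i ∩ ∁ W)
  v-width i = trans
    (edgeWidth-comm I′ conn {copy i v} {subdiv i} (glued⇒adjacent I uv c v-subdiv))
    (cong f (trans (V.v-side I uv c i)
      (trans (cong (_∩ part c i) (side-∁ I uv)) (∩-comm (∁ W) (part c i)))))

  -- X is the side of whichever end is cut off from u. Only that side is copied intact and
  -- homogeneous; symmetry of f makes the orientation harmless for the widths.
  copied-width : ∀ {x y} → Adjacent F x y → ∃ λ X → (X ⊆ W ⊎ X ⊆ ∁ W) × f X ≡ edgeWidth f D (x , y) ×
                 ∀ i → edgeWidth f G (copy i x , copy i y) ≡ f (X ∩ part c i)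
  copied-width {x} {y} xy with some-endpoint-away I uv c xy
  ... | inj₁ ¬xu = side D x y , Away.away-homogeneous I uv c xy ¬xu , refl ,
    λ i → cong f (Away.away-side I uv c xy ¬xu i)
  ... | inj₂ ¬yu = side D y x , Away.away-homogeneous I uv c (adjacent-sym xy) ¬yu ,
    edgeWidth-comm I conn (proj₁ (adjacent-removeEdge⁻ {E = edges} xy)) ,
    λ i → trans
      (edgeWidth-comm I′ conn {copy i y} {copy i x} (glued⇒adjacent I uv c (copied (adjacent-sym xy))))
      (cong f (Away.away-side I uv c (adjacent-sym xy) ¬yu i))

  module _ (imp : IsImprovement f W (part c)) (stable : Stable conn W c)
           (edges-≤ : ∀ {e} → e ∈ edges → edgeWidth f D e ≤ f W) where
    open IsImprovement imp

    private
      k = f W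

      part-<k : ∀ i → f (part c i) < k
      part-<k i = ℕ.≤-<-trans (ℕ.m≤m+n _ _) (half i)

      -- The strict bound on twice a width forces k to be positive, which the uniqueness of the wide
      -- copy relies on.
      1≤k : 1 ≤ k
      1≤k = ℕ.≤-<-trans z≤n (half 0F)

      F⊆E : ∀ {e} → e ∈ F → e ∈ edges
      F⊆E e∈ = proj₁ (∈-filter⁻ (λ e → ¬? (joins? e u v)) {xs = edges} e∈)

    copied-≤ : ∀ {x y} i → (x , y) ∈ F → edgeWidth f G (copy i x , copy i y) ≤ edgeWidth f D (x , y)
    copied-≤ i e∈ with copied-width (∈⇒adjacent e∈)
    ... | X , hom , fX≡ , wᵢ≡ = subst₂ _≤_ (sym (wᵢ≡ i)) fX≡ (part-≤ conn W stable X i hom)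

    -- No edge of T is wider than k, so a copy of width k is at least as wide as X, which is the
    -- premise of `part-<-unique`.
    copied-≡k-unique : ∀ {x y i j} → (x , y) ∈ F → edgeWidth f G (copy i x , copy i y) ≡ k →
                       edgeWidth f G (copy j x , copy j y) ≡ k → i ≡ j
    copied-≡k-unique {i = i} {j} e∈ wᵢ≡k wⱼ≡k with copied-width (∈⇒adjacent e∈)
    ... | X , hom , fX≡ , w≡ = part-<-unique conn W stable hom
      (ℕ.≤-trans 1≤k (ℕ.≤-trans (ℕ.≤-reflexive (trans (sym wᵢ≡k) (w≡ i))) (part-≤ conn W stable X i hom)))
      (bound wᵢ≡k) (bound wⱼ≡k)
      where
      bound : ∀ {i} → edgeWidth f G (copy i _ , copy i _) ≡ k → f X ≤ f (X ∩ part c i)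
      bound {i} eq = ℕ.≤-trans (ℕ.≤-reflexive fX≡)
        (ℕ.≤-trans (edges-≤ (F⊆E e∈)) (ℕ.≤-reflexive (trans (sym eq) (w≡ i))))

    glued-edges-≤ : ∀ {e} → e ∈ LabelledGraph.edges G → edgeWidth f G e ≤ k
    glued-edges-≤ e∈ with find (∈-concatMap⁻ (block I uv c) {xs = allFin 3} e∈)
    ... | i , _ , here refl                 = ℕ.<⇒≤ (subst (_< k) (sym (centre-width i)) (part-<k i))
    ... | i , _ , there (here refl)         = ℕ.<⇒≤ (subst (_< k) (sym (u-width i)) (inside i))
    ... | i , _ , there (there (here refl)) = ℕ.<⇒≤ (subst (_< k) (sym (v-width i)) (outside i))
    ... | i , _ , there (there (there e∈i)) with ∈-map⁻ _ e∈i
    ...   | _ , e∈F , refl = ℕ.≤-trans (copied-≤ i e∈F) (edges-≤ (F⊆E e∈F))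

    private
      atK? = λ e → edgeWidth f G e ℕ.≟ k

      copied? : ∀ i → Decidable (λ e → edgeWidth f G (copy i (proj₁ e) , copy i (proj₂ e)) ≡ k)
      copied? i e = atK? (copy i (proj₁ e) , copy i (proj₂ e))

      block-count : ∀ i → length (filter atK? (block I uv c i)) ≡ length (filter (copied? i) F)
      block-count i = trans (cong length (trans
          (filter-reject atK? (λ eq → ℕ.<⇒≢ (part-<k i) (trans (sym (centre-width i)) eq))) (trans
          (filter-reject atK? (λ eq → ℕ.<⇒≢ (inside i) (trans (sym (u-width i)) eq)))
          (filter-reject atK? (λ eq → ℕ.<⇒≢ (outside i) (trans (sym (v-width i)) eq))))))
        (length-filter-map {N × N} atK? (λ (x , y) → copy i x , copy i y) F)

    glued-#edgesOfWidth-< : #edgesOfWidth f G k < #edgesOfWidth f D k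
    glued-#edgesOfWidth-< = begin-strict
      length (filter atK? (block I uv c 0F ++ (block I uv c 1F ++ (block I uv c 2F ++ []))))
        ≡⟨ length-filter-++ {N} atK? (block I uv c 0F) _ ⟩
      _ + length (filter atK? (block I uv c 1F ++ (block I uv c 2F ++ [])))
        ≡⟨ cong₂ _+_ (block-count 0F) (trans (length-filter-++ {N} atK? (block I uv c 1F) _)
             (cong₂ _+_ (block-count 1F) (trans (length-filter-++ {N} atK? (block I uv c 2F) [])
               (trans (ℕ.+-identityʳ _) (block-count 2F))))) ⟩
      length (filter (copied? 0F) F) + (length (filter (copied? 1F) F) + length (filter (copied? 2F) F))
        ≤⟨ length-filter-exclusive copied? (λ e → edgeWidth f D e ℕ.≟ k) F
             (λ {_} {i} e∈ eq → ℕ.≤-antisym (edges-≤ (F⊆E e∈))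
               (ℕ.≤-trans (ℕ.≤-reflexive (sym eq)) (copied-≤ i e∈)))
             copied-≡k-unique ⟩
      length (filter (λ e → edgeWidth f D e ℕ.≟ k) F)
        ≡⟨ cong length (filter-filter (λ e → edgeWidth f D e ℕ.≟ k) (λ e → ¬? (joins? e u v)) edges) ⟩
      _
        <⟨ removed ⟩
      #edgesOfWidth f D k ∎
      where
      open ℕ.≤-Reasoning
      -- Strictness comes from uv itself: it has width k in T but is missing from F.
      removed = let e , e∈ , j = find uv in
        length-filter-mono-< _ (λ e → edgeWidth f D e ℕ.≟ k) (λ _ → proj₂) e∈
          (λ (¬j , _) → ¬j j) (edgeWidth-joins I conn uv j)

    -- Taking "wider than k" as the predicate in `NoNewWidths` bounds the number of offending edges
    -- by zero, their number in the glued graph.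
    refinement-width : ∀ {R} → IsRefinement D u v (part c) R → width f R ≤ k
    refinement-width {R} (steps , _) = max≤v⁺ z≤n (All.map⁺ (All.tabulate λ e∈ → ℕ.≮⇒≥
      (length-filter-≡0 (λ e → k ℕ.<? edgeWidth f R e) {LabelledGraph.edges R}
        (ℕ.n≤0⇒n≡0 (ℕ.≤-trans (steps-noNewWidths conn I′ steps (k ℕ.<?_))
          (ℕ.≤-reflexive (cong length (filter-none (λ e → k ℕ.<? edgeWidth f G e)
            (All.tabulate λ e∈ → ℕ.≤⇒≯ (glued-edges-≤ e∈)))))))
        e∈)))

    refinement-#edgesOfWidth : ∀ {R} → IsRefinement D u v (part c) R → #edgesOfWidth f R k < #edgesOfWidth f D k
    refinement-#edgesOfWidth (steps , _) = ℕ.≤-<-trans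
      (steps-noNewWidths conn I′ steps (ℕ._≟ k)) glued-#edgesOfWidth-<

theorem4 : ∀ {n : ℕ} {f : Subset n → ℕ} → IsConnectivityFunction f →
    ∀ {N : Set} ⦃ dec : IsDecEquivalence {A = N} _≡_ ⦄
    {D : LabelledGraph n N} → IsBranchDecomposition D →
    ∀ {k h : ℕ} → width f D ≡ k → #edgesOfWidth f D k ≡ h → h ≥ 1 →
    ∀ {u v : N} → Adjacent (LabelledGraph.edges D) u v → edgeWidth f D (u , v) ≡ k →
    ∃ (IsImprovement f (side D u v)) →
    ∃ λ (C : Fin 3 → Subset n) →
    IsImprovement f (side D u v) C ×
    (∀ {R} → IsRefinement D u v C R → width f R ≤ k × #edgesOfWidth f R k < h)
theorem4 {f = f} conn {D = D} isBD width≡ refl _ {u} {v} uv refl ∃imp =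
  let c , imp           = improvement-colouring conn (side D u v) ∃imp
      d , imp′ , stable = stable-improvement conn (side D u v) c imp
                            (×-wellFounded <-wellFounded <-wellFounded _)
      I                 = branchDecomposition-invariant isBD
      -- Here k has been identified with the width of uv, so `width≡` says that uv attains the
      -- maximum.
      edges-≤ : ∀ {e} → e ∈ LabelledGraph.edges D → edgeWidth f D e ≤ edgeWidth f D (u , v)
      edges-≤ e∈ = ℕ.≤-trans (v≤max⁺ 0 _ (inj₂ (lose (∈-map⁺ _ e∈) ℕ.≤-refl))) (ℕ.≤-reflexive width≡)
  in part d , imp′ , λ r →
    refinement-width conn I uv d imp′ stable edges-≤ r ,
    refinement-#edgesOfWidth conn I uv d imp′ stable edges-≤ r
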